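{- For every $D, n \in \mathbb{N}$ and every $d \in \mathbb{Q}$ with $d > 1$, there exists a graph $G$ with $$ e(G) \le n^{2 - 1/d} \cdot 2^{C \sqrt{\log n}} $$ edges which is $\mathcal{H}_d^D(n)$-universal, where $C = C(D, d)$ is a constant depending only on $D$ and $d$.
   Context: All graphs are finite and simple. For a graph $H$, its density is $m(H) = \max_{H' \subseteq H} e(H')/v(H')$, where $e(\cdot)$ and $v(\cdot)$ denote numbers of edges and vertices. For $d \in \mathbb{Q}$ and $n, D \in \mathbb{N}$, $\mathcal{H}_d(n)$ is the family of all graphs on $n$ vertices with density at most $d$, and $\mathcal{H}_d^D(n)$ is the family of all $H \in \mathcal{H}_d(n)$ with maximum degree at most $D$. A graph $G$ is universal for a family $\mathcal{H}$ (or $\mathcal{H}$-universal) if every $H \in \mathcal{H}$ is a (not necessarily induced) subgraph of $G$. -}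

module Defs where

open import Data.Bool using (Bool; true; false; if_then_else_)
open import Data.Nat using (ℕ; zero; suc; _+_; _*_; _∸_; _^_; _≤_; _<?_)
open import Data.Fin using (Fin; toℕ)
open import Data.List using (List; allFin; map)
open import Data.Nat.ListAction using (sum)
open import Data.Integer using (+_; ∣_∣)
open import Data.Product using (Σ; _×_)
open import Relation.Binary.PropositionalEquality using (_≡_)
open import Relation.Nullary.Decidable using (⌊_⌋)
open import Function.Definitions using (Injective)
open import Data.Rational as ℚ using (ℚ; ↥_; ↧ₙ_)

record Graph (n : ℕ) : Set where
  field
    adj    : Fin n → Fin n → Bool
    sym    : ∀ i j → adj i j ≡ adj j i
    irrefl : ∀ i → adj i i ≡ false
open Graph public

edges : ∀ {n} → Graph n → ℕ
edges {n} G =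
  sum (map (λ i → sum (map (λ j →
    if ⌊ toℕ i <? toℕ j ⌋ then (if adj G i j then 1 else 0) else 0) (allFin n))) (allFin n))

deg : ∀ {n} → Graph n → Fin n → ℕ
deg {n} G i = sum (map (λ j → if adj G i j then 1 else 0) (allFin n))

_⊆G_ : ∀ {m n} → Graph m → Graph n → Set
_⊆G_ {m} {n} H G =
  Σ (Fin m → Fin n) λ f → Injective _≡_ _≡_ f × (∀ i j → adj H i j ≡ true → adj G (f i) (f j) ≡ true)

ℕtoℚ : ℕ → ℚ
ℕtoℚ k = + k ℚ./ 1

-- m(H) ≤ d, i.e. e(H')/v(H') ≤ d for every subgraph H' ⊆ H
-- (written as e(H') ≤ d · v(H'), which also covers the empty subgraph harmlessly).
DensityAtMost : ℚ → ∀ {n} → Graph n → Set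
DensityAtMost d H = ∀ m (H' : Graph m) → H' ⊆G H → ℕtoℚ (edges H') ℚ.≤ d ℚ.* ℕtoℚ m

InFamily : ℚ → ℕ → (n : ℕ) → Graph n → Set
InFamily d D n H = DensityAtMost d H × (∀ i → deg H i ≤ D)

Universal : ℚ → ℕ → ℕ → ∀ {N} → Graph N → Set
Universal d D n G = ∀ (H : Graph n) → InFamily d D n H → H ⊆G G

-- d = p/q in lowest terms, p = num d (when d > 0), q = den d
num : ℚ → ℕ
num d = ∣ ↥ d ∣

den : ℚ → ℕ
den d = ↧ₙ d

{-# OPTIONS --safe #-}

-- Write d = p/q and let s ≈ √(log n). In a graph H of density at most p/q, Hall's theorem distributes q copies
-- of every edge over its ends, at most p per vertex, and König's edge colouring turns this into p pseudoforests
-- covering every edge at least q times. Put letters from an alphabet of size 2^O(s) on the vertices and read, for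
-- every vertex and every pseudoforest, the s letters met along the parent map: then the ends of an edge get equal
-- or shifted words in at least q of the p coordinates. Vertices far apart in H read disjoint sets of letters, so by a
-- first-moment count some choice of letters gives no s + 2 pairwise far vertices the same words. As H has
-- bounded degree, only 2^O(s) vertices then share their words, and H embeds into a 2^O(s)-fold blow-up of the
-- graph on p-tuples of words in which neighbours are equal or shifted in at least q coordinates. There are about
-- n tuples, each with n^((p - q)/p) 2^O(s) neighbours.

module Submission where

open import Defs hiding (sym)
open import Data.Bool using (Bool; true; false; if_then_else_; _∧_; _∨_; not)
import Data.Bool.Properties as Bool
open import Data.Fin using (Fin; zero; suc; toℕ; fromℕ<; combine; remQuot; splitAt; _↑ˡ_; _↑ʳ_; _≟_)
open import Data.Fin.Properties using (any?; all?; suc-injective; toℕ-injective; toℕ<n; toℕ-fromℕ<; combine-injective;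
  combine-remQuot; remQuot-combine; splitAt-↑ˡ; splitAt-↑ʳ; ↑ˡ-injective; ↑ʳ-injective)
open import Data.Fin.Subset using (Subset)
open import Data.Fin.Subset.Properties using (anySubset?)
import Data.Integer as ℤ
import Data.Integer.Properties as ℤ
import Data.List as List
import Data.List.Properties as List
open import Data.Maybe using (Maybe; just; nothing; fromMaybe)
import Data.Maybe as Maybe
open import Data.Nat using (ℕ; zero; suc; _+_; _*_; _∸_; _^_; _≤_; _<_; z≤n; s≤s; _≤?_; _<?_; NonZero; >-nonZero; _/_; _%_)
open import Data.Nat.DivMod using (_mod_; m<n⇒m%n≡m; m%n<n; m≡m%n+[m/n]*n; m/n*n≤m)
open import Data.Nat.GeneralisedArithmetic using (iterate)
import Data.Nat.ListAction as ListAction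
open import Data.Nat.Properties hiding (_≟_; suc-injective)
open import Data.Nat.Solver using (module +-*-Solver)
open import Data.Product using (Σ; ∃-syntax; _×_; _,_; proj₁; proj₂; uncurry)
open import Data.Rational as ℚ using (ℚ; 1ℚ; mkℚ; toℚᵘ)
import Data.Rational.Properties as ℚ
open import Data.Rational.Unnormalised as ℚᵘ using (mkℚᵘ)
import Data.Rational.Unnormalised.Properties as ℚᵘ
open import Data.Sum using (_⊎_; inj₁; inj₂; [_,_]′)
open import Data.Vec as Vec using (Vec; []; _∷_; lookup; _[_]≔_; _∷ʳ_)
import Data.Vec.Properties as Vec
open import Function using (_∘_; id; case_of_)
open import Function.Definitions using (Injective)
open import Relation.Binary.Definitions using (tri<; tri≈; tri>)
open import Relation.Binary.PropositionalEquality hiding ([_])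
open import Relation.Nullary using (¬_; Dec; yes; no; does; contradiction; ¬?; _×-dec_; _→-dec_)
open import Relation.Nullary.Decidable using (⌊_⌋; decidable-stable)
open import Algebra.Properties.Semiring.Sum +-*-semiring

-- Choice of parameters

-- With a letters' worth of bits per symbol, a word tuple carries a s p bits, and this must reach
-- log n. A linked coordinate costs a neighbour one unknown letter, a factor 2^a, while collisions
-- cost balls whose radius is proportional to s. Longer words enlarge the second loss and shorter
-- words the first; length √(log n) keeps both at 2^O(s). Random letters cannot be expected to
-- separate all vertices, since there are hardly more tuples than vertices. Each vertex has a slack
-- of only 2^s, but over s + 1 comparisons the slack outweighs the surplus factor n in the number of
-- (s + 2)-tuples of vertices. The obstacle is independence: a walk that enters a short cycle would
-- read the same letters again. It therefore halts at a representative of the cycle, and a counter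
-- gives it fresh letters there. As all vertices of the cycle share the representative, they get
-- equal words, which is why links allow equality besides shifts. Real exponents are avoided by
-- comparing p-th powers.

least : ∀ m {P : ℕ → Set} → (∀ s → Dec (P s)) → P m → ∃[ s ] (P s × (∀ t → P t → s ≤ t))
least zero    P? h = 0 , h , λ _ _ → z≤n
least (suc m) P? h with P? 0
... | yes p = 0 , p , λ _ _ → z≤n
... | no ¬p with least m (P? ∘ suc) h
...   | s , hs , min = suc s , hs , λ { zero q → contradiction q ¬p ; (suc t) q → s≤s (min t q) }

n<2^n : ∀ n → n < 2 ^ n
n<2^n zero    = s≤s z≤n
n<2^n (suc n) = begin-strict
  suc n          ≤⟨ n<2^n n ⟩
  2 ^ n          <⟨ m<m+n (2 ^ n) (m^n>0 2 n) ⟩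
  2 ^ n + 2 ^ n  ≡⟨ cong (2 ^ n +_) (+-identityʳ (2 ^ n)) ⟨
  2 ^ suc n      ∎
  where open ≤-Reasoning

<suc[/]* : ∀ s p .{{_ : NonZero p}} → s < suc (s / p) * p
<suc[/]* s p = begin-strict
  s                     ≡⟨ m≡m%n+[m/n]*n s p ⟩
  s % p + s / p * p     <⟨ +-monoˡ-< (s / p * p) (m%n<n s p) ⟩
  p + s / p * p         ∎
  where open ≤-Reasoning

-- A p-tuple of words has at least n 2 ^ s values (s = suc l), and (2 ^ s) ^ suc s exceeds the extra factor
-- n ≤ 2 ^ (s s) on the left.
enough-words : ∀ n a p l → n ≤ 2 ^ (suc l * suc l) → suc l < a * p →
  n ^ suc (suc (suc l)) < (2 ^ a) ^ (suc (suc l) * (p * suc l))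
enough-words n a p l n≤ s<ap = begin-strict
  n ^ suc k                       ≤⟨ ^-monoˡ-≤ (suc k) n≤ ⟩
  (2 ^ (s * s)) ^ suc k           ≡⟨ ^-*-assoc 2 (s * s) (suc k) ⟩
  2 ^ (s * s * suc k)             <⟨ ^-monoʳ-< 2 (s≤s (s≤s z≤n)) exponent ⟩
  2 ^ (a * (k * (p * s)))         ≡⟨ ^-*-assoc 2 a (k * (p * s)) ⟨
  (2 ^ a) ^ (k * (p * s))         ∎
  where
  open ≤-Reasoning
  open +-*-Solver
  s = suc l
  k = suc s
  exponent : s * s * suc k < a * (k * (p * s))
  exponent = begin-strict
    s * s * suc k          ≡⟨ solve 1 (λ s → s :* s :* (con 2 :+ s) := s :* s :+ s :* (s :+ s :* s)) refl s ⟩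
    s * s + s * (s + s * s) <⟨ +-monoˡ-< (s * (s + s * s)) (m<n+m (s * s) (s≤s z≤n)) ⟩
    s + s * s + s * (s + s * s) ≡⟨ solve 1 (λ s → s :+ s :* s :+ s :* (s :+ s :* s) := (con 1 :+ s) :* ((con 1 :+ s) :* s)) refl s ⟩
    k * (k * s)            ≤⟨ *-monoʳ-≤ k (*-monoˡ-≤ s s<ap) ⟩
    k * (a * p * s)        ≡⟨ solve 4 (λ k a p s → k :* (a :* p :* s) := a :* (k :* (p :* s))) refl k a p s ⟩
    a * (k * (p * s))      ∎

-- The left side is `fibreBound` at `k` = s + 1: that many balls of radius 4s cover a fibre. Both
-- factors are estimated by x < 2^x.
fibre-exponent : ∀ D l → suc (suc l) * suc D ^ ((suc l + suc l) + (suc l + suc l)) ≤ 2 ^ (suc l + D * (4 * suc l))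
fibre-exponent D l = begin
  suc s * suc D ^ ((s + s) + (s + s))   ≡⟨ cong (λ e → suc s * suc D ^ e) (solve 1 (λ s → (s :+ s) :+ (s :+ s) := con 4 :* s) refl s) ⟩
  suc s * suc D ^ (4 * s)               ≤⟨ *-mono-≤ (n<2^n s) (^-monoˡ-≤ (4 * s) (n<2^n D)) ⟩
  2 ^ s * (2 ^ D) ^ (4 * s)             ≡⟨ cong (2 ^ s *_) (^-*-assoc 2 D (4 * s)) ⟩
  2 ^ s * 2 ^ (D * (4 * s))             ≡⟨ ^-distribˡ-+-* 2 s (D * (4 * s)) ⟨
  2 ^ (s + D * (4 * s))                 ∎
  where
  open ≤-Reasoning
  open +-*-Solver
  s = suc l

-- Binary logarithm of twice the number of vertices times the number of moves: `a * s * p` stands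
-- for the word tuples, `(2 + a) * p` for the tags and letters of a move, `a * s * r` for its fresh
-- words, and each `κ` for the choice of a copy.
edge-exponent : ℕ → ℕ → ℕ → ℕ → ℕ → ℕ
edge-exponent a s p r κ = 1 + ((a * s * p + κ) + (((2 + a) * p + a * s * r) + κ))

edge-power : ∀ a s p r κ K → K ≤ 2 ^ κ →
  2 * ((((2 ^ a) ^ s) ^ p * K) * (((4 * 2 ^ a) ^ p * ((2 ^ a) ^ s) ^ r) * K)) ≤ 2 ^ edge-exponent a s p r κ
edge-power a s p r κ K K≤ = begin
  2 * ((((2 ^ a) ^ s) ^ p * K) * (((4 * 2 ^ a) ^ p * ((2 ^ a) ^ s) ^ r) * K))
    ≤⟨ *-monoʳ-≤ 2 (*-mono-≤ (*-monoʳ-≤ (((2 ^ a) ^ s) ^ p) K≤) (*-monoʳ-≤ ((4 * 2 ^ a) ^ p * ((2 ^ a) ^ s) ^ r) K≤)) ⟩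
  2 * ((((2 ^ a) ^ s) ^ p * 2 ^ κ) * (((4 * 2 ^ a) ^ p * ((2 ^ a) ^ s) ^ r) * 2 ^ κ))
    ≡⟨ cong (2 *_) (cong₂ _*_ (cong (_* 2 ^ κ) (word-power p))
         (cong (_* 2 ^ κ) (cong₂ _*_ (trans (cong (_^ p) (sym (^-distribˡ-+-* 2 2 a))) (^-*-assoc 2 (2 + a) p)) (word-power r)))) ⟩
  2 * ((2 ^ (a * s * p) * 2 ^ κ) * ((2 ^ ((2 + a) * p) * 2 ^ (a * s * r)) * 2 ^ κ))
    ≡⟨ cong (2 *_) (cong₂ _*_ (^-distribˡ-+-* 2 (a * s * p) κ)
         (trans (^-distribˡ-+-* 2 ((2 + a) * p + a * s * r) κ) (cong (_* 2 ^ κ) (^-distribˡ-+-* 2 ((2 + a) * p) (a * s * r))))) ⟨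
  2 * (2 ^ (a * s * p + κ) * 2 ^ (((2 + a) * p + a * s * r) + κ))
    ≡⟨ cong (2 *_) (^-distribˡ-+-* 2 (a * s * p + κ) (((2 + a) * p + a * s * r) + κ)) ⟨
  2 ^ edge-exponent a s p r κ ∎
  where
  open ≤-Reasoning
  word-power : ∀ m → ((2 ^ a) ^ s) ^ m ≡ 2 ^ (a * s * m)
  word-power m = trans (cong (_^ m) (^-*-assoc 2 a s)) (^-*-assoc 2 (a * s) m)

-- The coefficient of p s that remains in `exponent-bound`. The summand `8 * D` comes from the two
-- terms κ = s + 4 D s, and `5 * p` from the tags and from rounding `a` up.
constant : ℕ → ℕ → ℕ
constant D p = 8 + 8 * D + 5 * p

-- By a p ≤ s + p the leading term a p s (p + r) is s² (p + r) up to a multiple of s. It is compared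
-- with l², where l = s - 1, because the available lower bound on n is 2^(l²); the difference 2s - 1
-- is again linear.
exponent-bound : ∀ D a l p r → a * p ≤ suc l + p → r ≤ p →
  edge-exponent a (suc l) p r (suc l + D * (4 * suc l)) * p ≤ l * l * (p + r) + p * constant D p * suc l
exponent-bound D a l p r ap≤ r≤p = begin
  edge-exponent a s p r κ * p
    ≡⟨ solve 5 (λ a s p r κ → (con 1 :+ ((a :* s :* p :+ κ) :+ (((con 2 :+ a) :* p :+ a :* s :* r) :+ κ))) :* p
         := (p :+ con 2 :* κ :* p :+ con 2 :* p :* p) :+ (p :* (a :* p) :+ a :* p :* (s :* (p :+ r)))) refl a s p r κ ⟩
  (p + 2 * κ * p + 2 * p * p) + (p * (a * p) + a * p * (s * (p + r)))
    ≤⟨ +-monoʳ-≤ (p + 2 * κ * p + 2 * p * p) (+-mono-≤ (*-monoʳ-≤ p ap≤) (*-monoˡ-≤ (s * (p + r)) ap≤)) ⟩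
  (p + 2 * κ * p + 2 * p * p) + (p * (s + p) + (s + p) * (s * (p + r)))
    ≡⟨ solve 5 (λ l p r D κ → let s = con 1 :+ l in
         (p :+ con 2 :* κ :* p :+ con 2 :* p :* p) :+ (p :* (s :+ p) :+ (s :+ p) :* (s :* (p :+ r)))
         := l :* l :* (p :+ r) :+ ((p :+ con 2 :* κ :* p :+ con 2 :* p :* p) :+ (p :* (s :+ p) :+ (l :+ s :+ p :* s) :* (p :+ r)))) refl l p r D κ ⟩
  l * l * (p + r) + ((p + 2 * κ * p + 2 * p * p) + (p * (s + p) + (l + s + p * s) * (p + r)))
    ≤⟨ +-monoʳ-≤ (l * l * (p + r)) (+-mono-≤
         (+-mono-≤ (+-monoˡ-≤ (2 * κ * p) (m≤m*n p s)) (m≤m*n (2 * p * p) s))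
         (+-mono-≤ (*-monoʳ-≤ p (+-monoʳ-≤ s (m≤m*n p s)))
                   (*-mono-≤ (+-monoˡ-≤ (p * s) (+-monoˡ-≤ s (n≤1+n l))) (+-monoʳ-≤ p r≤p)))) ⟩
  l * l * (p + r) + ((p * s + 2 * κ * p + 2 * p * p * s) + (p * (s + p * s) + (s + s + p * s) * (p + p)))
    ≡⟨ cong (l * l * (p + r) +_) (solve 3 (λ s p D →
         (p :* s :+ con 2 :* (s :+ D :* (con 4 :* s)) :* p :+ con 2 :* p :* p :* s) :+ (p :* (s :+ p :* s) :+ (s :+ s :+ p :* s) :* (p :+ p))
         := p :* (con 8 :+ con 8 :* D :+ con 5 :* p) :* s) refl s p D) ⟩
  l * l * (p + r) + p * constant D p * s ∎
  where
  open ≤-Reasoning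
  open +-*-Solver
  s = suc l
  κ = s + D * (4 * s)

edge-bound : ∀ D n a l p r {e} → a * p ≤ suc l + p → r ≤ p → 2 ^ (l * l) ≤ n →
  e ≤ 2 ^ edge-exponent a (suc l) p r (suc l + D * (4 * suc l)) →
  ∀ s → suc l ≤ s → e ^ p ≤ n ^ (p + r) * 2 ^ (p * constant D p * s)
edge-bound D n a l p r {e} ap≤ r≤p ≤n e≤ s l<s = begin
  e ^ p                                                             ≤⟨ ^-monoˡ-≤ p e≤ ⟩
  (2 ^ x) ^ p                                                       ≡⟨ ^-*-assoc 2 x p ⟩
  2 ^ (x * p)                                                       ≤⟨ ^-monoʳ-≤ 2 (exponent-bound D a l p r ap≤ r≤p) ⟩
  2 ^ (l * l * (p + r) + p * constant D p * suc l)                  ≡⟨ ^-distribˡ-+-* 2 (l * l * (p + r)) (p * constant D p * suc l) ⟩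
  2 ^ (l * l * (p + r)) * 2 ^ (p * constant D p * suc l)            ≡⟨ cong (_* 2 ^ (p * constant D p * suc l)) (^-*-assoc 2 (l * l) (p + r)) ⟨
  (2 ^ (l * l)) ^ (p + r) * 2 ^ (p * constant D p * suc l)          ≤⟨ *-mono-≤ (^-monoˡ-≤ (p + r) ≤n) (^-monoʳ-≤ 2 (*-monoʳ-≤ (p * constant D p) l<s)) ⟩
  n ^ (p + r) * 2 ^ (p * constant D p * s)                          ∎
  where
  open ≤-Reasoning
  x = edge-exponent a (suc l) p r (suc l + D * (4 * suc l))

private
  variable
    a b m n k : ℕ

-- Indicators, counting and finite sums

χ : Bool → ℕ
χ b = if b then 1 else 0

δ : Fin n → Fin n → ℕ
δ i j = χ (does (i ≟ j))

count : (Fin n → Bool) → ℕ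
count P = sum (λ i → χ (P i))

χ≤1 : ∀ b → χ b ≤ 1
χ≤1 true  = ≤-refl
χ≤1 false = z≤n

χ-pos : ∀ {b} → 1 ≤ χ b → b ≡ true
χ-pos {true} _ = refl

χ-mono : ∀ {b c} → (b ≡ true → c ≡ true) → χ b ≤ χ c
χ-mono {false} h = z≤n
χ-mono {true}  h rewrite h refl = ≤-refl

∧-true : ∀ {b c} → b ∧ c ≡ true → b ≡ true × c ≡ true
∧-true {true} {true} _ = refl , refl

∨-true : ∀ {b c} → b ∨ c ≡ true → b ≡ true ⊎ c ≡ true
∨-true {true}  _ = inj₁ refl
∨-true {false} h = inj₂ h

∨-trueʳ : ∀ b {c} → c ≡ true → b ∨ c ≡ true
∨-trueʳ true  _ = refl
∨-trueʳ false h = h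

does-true : ∀ {p} {P : Set p} (P? : Dec P) → P → does P? ≡ true
does-true (yes _) _ = refl
does-true (no ¬p) p = contradiction p ¬p

true-does : ∀ {p} {P : Set p} (P? : Dec P) → does P? ≡ true → P
true-does (yes p) _ = p

δ-refl : (i : Fin n) → δ i i ≡ 1
δ-refl i = cong χ (does-true (i ≟ i) refl)

δ-≢ : {i j : Fin n} → i ≢ j → δ i j ≡ 0
δ-≢ {i = i} {j} i≢j with i ≟ j
... | yes i≡j = contradiction i≡j i≢j
... | no  _   = refl

sum-mono : {f g : Fin n → ℕ} → (∀ i → f i ≤ g i) → sum f ≤ sum g
sum-mono {zero}  h = z≤n
sum-mono {suc n} h = +-mono-≤ (h zero) (sum-mono (h ∘ suc))

sum-mono-< : {f g : Fin n → ℕ} → (∀ i → f i ≤ g i) → ∀ i → f i < g i → sum f < sum g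
sum-mono-< h zero    lt = +-mono-<-≤ lt (sum-mono (h ∘ suc))
sum-mono-< h (suc i) lt = +-mono-≤-< (h zero) (sum-mono-< (h ∘ suc) i lt)

sum-const : ∀ n c → sum {n} (λ _ → c) ≡ n * c
sum-const zero    c = refl
sum-const (suc n) c = cong (c +_) (sum-const n c)

term≤sum : (f : Fin n → ℕ) → ∀ i → f i ≤ sum f
term≤sum f zero    = m≤m+n _ _
term≤sum f (suc i) = ≤-trans (term≤sum (f ∘ suc) i) (m≤n+m _ _)

sum-pos : (f : Fin n → ℕ) → 1 ≤ sum f → ∃[ i ] 1 ≤ f i
sum-pos {suc n} f h with f zero in eq
... | suc _ = zero , subst (1 ≤_) (sym eq) (s≤s z≤n)
... | zero  with sum-pos (f ∘ suc) h
...   | i , hi = suc i , hi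

sum-zero : {f : Fin n → ℕ} → (∀ i → f i ≡ 0) → sum f ≡ 0
sum-zero {n} h = trans (sum-cong-≗ h) (trans (sum-const n 0) (*-zeroʳ n))

sum-δ : (i : Fin n) (g : Fin n → ℕ) → sum (λ j → δ i j * g j) ≡ g i
sum-δ {suc n} zero g = trans (cong₂ _+_ (+-identityʳ (g zero)) (sum-zero {n} {λ _ → 0} (λ _ → refl))) (+-identityʳ _)
sum-δ (suc i) g = sum-δ i (g ∘ suc)

sum-δ₁ : (i : Fin n) → sum (δ i) ≡ 1
sum-δ₁ i = trans (sum-cong-≗ (λ j → sym (*-identityʳ (δ i j)))) (sum-δ i (λ _ → 1))

δ-sym : (i j : Fin n) → δ i j ≡ δ j i
δ-sym zero    zero    = refl
δ-sym zero    (suc j) = refl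
δ-sym (suc i) zero    = refl
δ-sym (suc i) (suc j) = δ-sym i j

sum-++ : ∀ m {n} (f : Fin (m + n) → ℕ) →
  sum f ≡ sum (λ i → f (i ↑ˡ n)) + sum (λ j → f (m ↑ʳ j))
sum-++ zero    f = refl
sum-++ (suc m) f = trans (cong (f zero +_) (sum-++ m (f ∘ suc))) (sym (+-assoc (f zero) _ _))

sum-combine : ∀ m {n} (f : Fin (m * n) → ℕ) →
  sum f ≡ sum (λ i → sum (λ j → f (combine {m} {n} i j)))
sum-combine zero        f = refl
sum-combine (suc m) {n} f = trans (sum-++ n f) (cong (sum (λ i → f (i ↑ˡ m * n)) +_) (sum-combine m (λ j → f (n ↑ʳ j))))

sum-fibre≤1 : (f : Fin m → Fin n) → Injective _≡_ _≡_ f → ∀ j → sum (λ i → δ (f i) j) ≤ 1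
sum-fibre≤1 {zero}  f inj j = z≤n
sum-fibre≤1 {suc m} f inj j with f zero ≟ j
... | yes refl = s≤s (≤-reflexive (sum-zero {f = λ i → δ (f (suc i)) (f zero)} (λ i → δ-≢ (λ e → case inj e of λ ()))))
... | no _ = sum-fibre≤1 (f ∘ suc) (λ e → suc-injective (inj e)) j

anyᵇ : (Fin n → Bool) → Bool
anyᵇ P = does (any? (λ i → P i Bool.≟ true))

anyᵇ-intro : (P : Fin n → Bool) → ∀ i → P i ≡ true → anyᵇ P ≡ true
anyᵇ-intro P i h = does-true (any? (λ i → P i Bool.≟ true)) (i , h)

anyᵇ-elim : (P : Fin n → Bool) → anyᵇ P ≡ true → ∃[ i ] P i ≡ true
anyᵇ-elim P = true-does (any? (λ i → P i Bool.≟ true))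

-- Hall's theorem

nbhd : (Fin a → Fin b → Bool) → (Fin a → Bool) → Fin b → Bool
nbhd R S y = anyᵇ (λ x → S x ∧ R x y)

nbhd-intro : (R : Fin a → Fin b → Bool) (S : Fin a → Bool) → ∀ {x y} → S x ≡ true → R x y ≡ true → nbhd R S y ≡ true
nbhd-intro R S {x} {y} s r = anyᵇ-intro (λ x → S x ∧ R x y) x (cong₂ _∧_ s r)

nbhd-elim : (R : Fin a → Fin b → Bool) (S : Fin a → Bool) → ∀ {y} → nbhd R S y ≡ true → ∃[ x ] (S x ≡ true × R x y ≡ true)
nbhd-elim R S {y} h with anyᵇ-elim (λ x → S x ∧ R x y) h
... | x , e = x , ∧-true e

Hall : (Fin a → Fin b → Bool) → Set
Hall {a} R = (S : Fin a → Bool) → count S ≤ count (nbhd R S)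

nbhd-mono : (R : Fin a → Fin b → Bool) {S S′ : Fin a → Bool} → (∀ x → S x ≡ true → S′ x ≡ true) →
  ∀ y → nbhd R S y ≡ true → nbhd R S′ y ≡ true
nbhd-mono R {S} {S′} h y e with nbhd-elim R S e
... | x , s , r = nbhd-intro R S′ (h x s) r

-- Sets given as Boolean functions are replaced by their tabulations, over which the search for a
-- violator is finite. Tabulating keeps the size of the set and, by `nbhd-mono`, does not enlarge
-- its neighbourhood.
hall? : (R : Fin a → Fin b → Bool) → Hall R ⊎ ∃[ S ] count (nbhd R S) < count S
hall? {a} R with anySubset? (λ (S : Subset a) → count (nbhd R (lookup S)) <? count (lookup S))
... | yes (S , h) = inj₂ (lookup S , h)
... | no  h = inj₁ λ S → begin
    count S                                  ≡⟨ sum-cong-≗ (λ i → cong χ (sym (Vec.lookup∘tabulate S i))) ⟩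
    count (lookup (Vec.tabulate S))              ≤⟨ ≮⇒≥ (λ lt → h (Vec.tabulate S , lt)) ⟩
    count (nbhd R (lookup (Vec.tabulate S)))     ≤⟨ sum-mono (λ y → χ-mono (nbhd-mono R (λ x → trans (sym (Vec.lookup∘tabulate S x))) y)) ⟩
    count (nbhd R S)                         ∎
  where open ≤-Reasoning

delete : (Fin a → Fin b → Bool) → Fin a → Fin b → Fin a → Fin b → Bool
delete R x y x′ y′ = R x′ y′ ∧ not (does (x ≟ x′) ∧ does (y ≟ y′))

delete-⊆ : (R : Fin a → Fin b → Bool) → ∀ x y x′ y′ → delete R x y x′ y′ ≡ true → R x′ y′ ≡ true
delete-⊆ R x y x′ y′ h = proj₁ (∧-true h)

delete-keep : (R : Fin a → Fin b → Bool) → ∀ x y x′ y′ → x ≢ x′ ⊎ y ≢ y′ → R x′ y′ ≡ true → delete R x y x′ y′ ≡ true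
delete-keep R x y x′ y′ ne r rewrite r with x ≟ x′ | y ≟ y′
... | no _  | _     = refl
... | yes _ | no _  = refl
... | yes e | yes f = [ contradiction e , contradiction f ]′ ne

delete-hit : (R : Fin a → Fin b → Bool) → ∀ x y → delete R x y x y ≡ false
delete-hit R x y rewrite does-true (x ≟ x) refl | does-true (y ≟ y) refl = Bool.∧-zeroʳ (R x y)

size : (Fin a → Fin b → Bool) → ℕ
size R = sum (λ x → count (R x))

delete-size : (R : Fin a → Fin b → Bool) → ∀ x y → R x y ≡ true → size (delete R x y) < size R
delete-size R x y r =
  sum-mono-< (λ x′ → sum-mono (λ y′ → χ-mono (delete-⊆ R x y x′ y′))) x
    (sum-mono-< (λ y′ → χ-mono (delete-⊆ R x y x y′)) y
      (subst₂ _<_ (cong χ (sym (delete-hit R x y))) (cong χ (sym r)) (s≤s z≤n)))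

χ-uncross : ∀ p q r s → (p ≡ true → r ∨ s ≡ true) → (q ≡ true → r ≡ true × s ≡ true) → χ p + χ q ≤ χ r + χ s
χ-uncross false false r s f g = z≤n
χ-uncross true  false r s f g with r | s | f refl
... | true  | _    | _ = s≤s z≤n
... | false | true | _ = s≤s z≤n
χ-uncross true true r s f g with g refl
... | refl , refl = ≤-refl
χ-uncross false true r s f g with g refl
... | refl , refl = s≤s z≤n

-- Rado's argument: if deleting either of two edges at x broke Hall's condition, then uncrossing the
-- two violating sets would violate it before the deletion.
delete-one : (R : Fin a → Fin b → Bool) → Hall R → ∀ x {y₁ y₂} → y₁ ≢ y₂ →
  Hall (delete R x y₁) ⊎ Hall (delete R x y₂)
delete-one {a} {b} R hall x {y₁} {y₂} y₁≢y₂ with hall? (delete R x y₁) | hall? (delete R x y₂)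
... | inj₁ h | _ = inj₁ h
... | inj₂ _ | inj₁ h = inj₂ h
... | inj₂ (S₁ , v₁) | inj₂ (S₂ , v₂) = contradiction total (<⇒≱ (n<1+n _))
  where
  R₁ = delete R x y₁
  R₂ = delete R x y₂
  -- A violating set must contain `x`: otherwise it loses no edge in the deletion and `hall S` still
  -- applies.
  x∈ : ∀ y S → count (nbhd (delete R x y) S) < count S → S x ≡ true
  x∈ y S v with S x in eq
  ... | true  = refl
  ... | false = contradiction (≤-trans (hall S) (sum-mono (λ y′ → χ-mono (sub y′)))) (<⇒≱ v)
    where
    sub : ∀ y′ → nbhd R S y′ ≡ true → nbhd (delete R x y) S y′ ≡ true
    sub y′ e with nbhd-elim R S e
    ... | x′ , s , r = nbhd-intro (delete R x y) S s
      (delete-keep R x y x′ y′ (inj₁ λ { refl → case trans (sym eq) s of λ () }) r)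
  union inter : Fin a → Bool
  union z = S₁ z ∨ S₂ z
  -- Without `x`, the edges at the intersection survive both deletions. Dropping `x` costs one
  -- element (the summand `δ x z` below), while the two strict violations together gain two.
  inter z = (S₁ z ∧ S₂ z) ∧ not (does (x ≟ z))
  sets : ∀ z → χ (S₁ z) + χ (S₂ z) ≤ (χ (union z) + χ (inter z)) + δ x z
  sets z with S₁ z | S₂ z | x ≟ z
  ... | true  | true  | yes _ = ≤-refl
  ... | true  | true  | no  _ = ≤-refl
  ... | true  | false | yes _ = s≤s z≤n
  ... | true  | false | no  _ = ≤-refl
  ... | false | true  | yes _ = s≤s z≤n
  ... | false | true  | no  _ = ≤-refl
  ... | false | false | _     = z≤n
  nbhds : ∀ y → χ (nbhd R union y) + χ (nbhd R inter y) ≤ χ (nbhd R₁ S₁ y) + χ (nbhd R₂ S₂ y)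
  nbhds y = χ-uncross _ _ _ _ onUnion onInter
    where
    onUnion : nbhd R union y ≡ true → nbhd R₁ S₁ y ∨ nbhd R₂ S₂ y ≡ true
    onUnion e = let z , s , r = nbhd-elim R union e in go s r (x ≟ z) (y₁ ≟ y)
      where
      go : ∀ {z} → union z ≡ true → R z y ≡ true → Dec (x ≡ z) → Dec (y₁ ≡ y) → nbhd R₁ S₁ y ∨ nbhd R₂ S₂ y ≡ true
      -- An edge at `x` survives one of the two deletions, because `y` cannot equal both `y₁` and
      -- `y₂`.
      go s r (yes refl) (no y₁≢y) =
        cong (_∨ nbhd R₂ S₂ y) (nbhd-intro R₁ S₁ (x∈ y₁ S₁ v₁) (delete-keep R x y₁ x y (inj₂ y₁≢y) r))
      go s r (yes refl) (yes refl) =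
        ∨-trueʳ (nbhd R₁ S₁ y) (nbhd-intro R₂ S₂ (x∈ y₂ S₂ v₂) (delete-keep R x y₂ x y (inj₂ (y₁≢y₂ ∘ sym)) r))
      go {z} s r (no x≢z) _ with ∨-true {S₁ z} s
      ... | inj₁ s₁ = cong (_∨ nbhd R₂ S₂ y) (nbhd-intro R₁ S₁ s₁ (delete-keep R x y₁ z y (inj₁ x≢z) r))
      ... | inj₂ s₂ = ∨-trueʳ (nbhd R₁ S₁ y) (nbhd-intro R₂ S₂ s₂ (delete-keep R x y₂ z y (inj₁ x≢z) r))
    onInter : nbhd R inter y ≡ true → nbhd R₁ S₁ y ≡ true × nbhd R₂ S₂ y ≡ true
    onInter e =
      let z , s , r = nbhd-elim R inter e
          s₁₂ , t   = ∧-true {S₁ z ∧ S₂ z} s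
          s₁ , s₂   = ∧-true {S₁ z} s₁₂
          x≢z       = λ x≡z → case trans (sym (cong not (does-true (x ≟ z) x≡z))) t of λ ()
      in nbhd-intro R₁ S₁ s₁ (delete-keep R x y₁ z y (inj₁ x≢z) r)
       , nbhd-intro R₂ S₂ s₂ (delete-keep R x y₂ z y (inj₁ x≢z) r)
  total : suc (count (nbhd R₁ S₁) + count (nbhd R₂ S₂) + 1) ≤ count (nbhd R₁ S₁) + count (nbhd R₂ S₂) + 1
  total = begin
    suc (count (nbhd R₁ S₁) + count (nbhd R₂ S₂) + 1)        ≡⟨ cong suc (+-comm (count (nbhd R₁ S₁) + _) 1) ⟩
    suc (suc (count (nbhd R₁ S₁) + count (nbhd R₂ S₂)))      ≡⟨ cong suc (+-suc _ _) ⟨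
    suc (count (nbhd R₁ S₁)) + suc (count (nbhd R₂ S₂))      ≤⟨ +-mono-≤ v₁ v₂ ⟩
    count S₁ + count S₂                                      ≡⟨ ∑-distrib-+ (χ ∘ S₁) (χ ∘ S₂) ⟨
    sum (λ z → χ (S₁ z) + χ (S₂ z))                          ≤⟨ sum-mono sets ⟩
    sum (λ z → (χ (union z) + χ (inter z)) + δ x z)          ≡⟨ ∑-distrib-+ (λ z → χ (union z) + χ (inter z)) (δ x) ⟩
    sum (λ z → χ (union z) + χ (inter z)) + sum (δ x)        ≡⟨ cong₂ _+_ (∑-distrib-+ (χ ∘ union) (χ ∘ inter)) (sum-δ₁ x) ⟩
    count union + count inter + 1                            ≤⟨ +-monoˡ-≤ 1 (+-mono-≤ (hall union) (hall inter)) ⟩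
    count (nbhd R union) + count (nbhd R inter) + 1          ≡⟨ cong (_+ 1) (∑-distrib-+ (χ ∘ nbhd R union) (χ ∘ nbhd R inter)) ⟨
    sum (λ y → χ (nbhd R union y) + χ (nbhd R inter y)) + 1  ≤⟨ +-monoˡ-≤ 1 (sum-mono nbhds) ⟩
    sum (λ y → χ (nbhd R₁ S₁ y) + χ (nbhd R₂ S₂ y)) + 1      ≡⟨ cong (_+ 1) (∑-distrib-+ (χ ∘ nbhd R₁ S₁) (χ ∘ nbhd R₂ S₂)) ⟩
    count (nbhd R₁ S₁) + count (nbhd R₂ S₂) + 1              ∎
    where open ≤-Reasoning

Matching : (Fin a → Fin b → Bool) → Set
Matching {a} {b} R = Σ (Fin a → Fin b) λ f → Injective _≡_ _≡_ f × (∀ x → R x (f x) ≡ true)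

neighbour : (R : Fin a → Fin b → Bool) → Hall R → ∀ x → ∃[ y ] R x y ≡ true
neighbour R hall x =
  let y , h     = sum-pos _ (≤-trans (≤-reflexive (sym (sum-δ₁ x))) (hall (λ z → does (x ≟ z))))
      z , e , r = nbhd-elim R (λ z → does (x ≟ z)) (χ-pos h)
  in y , subst (λ z → R z y ≡ true) (sym (true-does (x ≟ z) e)) r

-- Hall's condition for the pair `x`, `x′`: with a common image, its neighbourhood would be a single
-- point.
functional-injective : (R : Fin a → Fin b → Bool) → Hall R → (f : Fin a → Fin b) →
  (∀ {x y} → R x y ≡ true → f x ≡ y) → Injective _≡_ _≡_ f
functional-injective {a} R hall f functional {x} {x′} fx≡fx′ =
  decidable-stable (x ≟ x′) λ x≢x′ → contradiction (two x≢x′) (<⇒≱ (n<1+n 1))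
  where
  pair : Fin a → Bool
  pair z = does (x ≟ z) ∨ does (x′ ≟ z)
  split : x ≢ x′ → ∀ z → δ x z + δ x′ z ≤ χ (pair z)
  split x≢x′ z with x ≟ z | x′ ≟ z
  ... | yes refl | yes refl = contradiction refl x≢x′
  ... | yes _    | no _     = ≤-refl
  ... | no _     | yes _    = ≤-refl
  ... | no _     | no _     = z≤n
  image : ∀ y → nbhd R pair y ≡ true → does (f x ≟ y) ≡ true
  image y e =
    let z , s , r = nbhd-elim R pair e
        fx≡fz = [ (λ h → cong f (true-does (x ≟ z) h))
                , (λ h → trans fx≡fx′ (cong f (true-does (x′ ≟ z) h))) ]′ (∨-true {does (x ≟ z)} s)
    in does-true (f x ≟ y) (trans fx≡fz (functional r))
  two : x ≢ x′ → 2 ≤ 1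
  two x≢x′ = begin
    2                             ≡⟨ cong₂ _+_ (sum-δ₁ x) (sum-δ₁ x′) ⟨
    sum (δ x) + sum (δ x′)        ≡⟨ ∑-distrib-+ (δ x) (δ x′) ⟨
    sum (λ z → δ x z + δ x′ z)    ≤⟨ sum-mono (split x≢x′) ⟩
    count pair                    ≤⟨ hall pair ⟩
    count (nbhd R pair)           ≤⟨ sum-mono (λ y → χ-mono (image y)) ⟩
    sum (δ (f x))                 ≡⟨ sum-δ₁ (f x) ⟩
    1                             ∎
    where open ≤-Reasoning

functional-matching : (R : Fin a → Fin b → Bool) → Hall R →
  (∀ x {y₁ y₂} → R x y₁ ≡ true → R x y₂ ≡ true → y₁ ≡ y₂) → Matching R
functional-matching R hall unique =
    (λ x → proj₁ (neighbour R hall x))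
  , functional-injective R hall (λ x → proj₁ (neighbour R hall x))
      (λ {x} r → unique x (proj₂ (neighbour R hall x)) r)
  , λ x → proj₂ (neighbour R hall x)

-- As long as some `x` has two neighbours, `delete-one` removes an edge and keeps Hall's condition.
-- Every round lowers the number of edges, which bounds the fuel, and at the end the relation itself
-- is the matching.
hall-matching : (R : Fin a → Fin b → Bool) → Hall R → Matching R
hall-matching R = go (suc (size R)) R ≤-refl
  where
  go : ∀ fuel (R : Fin a → Fin b → Bool) → size R < fuel → Hall R → Matching R
  go (suc fuel) R (s≤s lt) hall
    with any? (λ x → any? (λ y₁ → any? (λ y₂ → double x y₁ y₂)))
    where
    double : ∀ x y₁ y₂ → Dec (y₁ ≢ y₂ × R x y₁ ≡ true × R x y₂ ≡ true)
    double x y₁ y₂ = ¬? (y₁ ≟ y₂) ×-dec (R x y₁ Bool.≟ true) ×-dec (R x y₂ Bool.≟ true)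
  ... | no simple = functional-matching R hall unique
    where
    unique : ∀ x {y₁ y₂} → R x y₁ ≡ true → R x y₂ ≡ true → y₁ ≡ y₂
    unique x {y₁} {y₂} r₁ r₂ with y₁ ≟ y₂
    ... | yes e = e
    ... | no ne = contradiction (x , y₁ , y₂ , ne , r₁ , r₂) simple
  ... | yes (x , y₁ , y₂ , ne , r₁ , r₂) =
    [ (λ h → weaken y₁ (go fuel (delete R x y₁) (≤-trans (delete-size R x y₁ r₁) lt) h))
    , (λ h → weaken y₂ (go fuel (delete R x y₂) (≤-trans (delete-size R x y₂ r₂) lt) h)) ]′
    (delete-one R hall x ne)
    where
    weaken : ∀ y → Matching (delete R x y) → Matching R
    weaken y (f , inj , h) = f , inj , λ z → delete-⊆ R x y z (f z) (h z)

-- König's edge colouring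

support : (Fin a → Fin b → ℕ) → Fin a → Fin b → Bool
support P i j = does (1 ≤? P i j)

-- Double counting: the rows in `S` carry total weight (k + 1) times the size of `S`, all of it in
-- the columns `T`, which can hold (k + 1) times the size of `T`.
support-hall : (P : Fin a → Fin b → ℕ) → (∀ i → sum (P i) ≡ suc k) → (∀ j → sum (λ i → P i j) ≡ suc k) →
  Hall (support P)
support-hall {a} {b} {k} P rows cols S = *-cancelˡ-≤ (suc k) (begin
  suc k * count S                              ≡⟨ *-distribˡ-sum (suc k) (χ ∘ S) ⟩
  sum (λ i → suc k * χ (S i))                  ≡⟨ sum-cong-≗ (λ i → trans (*-comm (suc k) (χ (S i)))
                                                    (trans (cong (χ (S i) *_) (sym (rows i))) (*-distribˡ-sum (χ (S i)) (P i)))) ⟩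
  sum (λ i → sum (λ j → χ (S i) * P i j))      ≤⟨ sum-mono (λ i → sum-mono (λ j → entry i j)) ⟩
  sum (λ i → sum (λ j → χ (T j) * P i j))      ≡⟨ ∑-comm (λ i j → χ (T j) * P i j) ⟩
  sum (λ j → sum (λ i → χ (T j) * P i j))      ≡⟨ sum-cong-≗ (λ j → trans (sym (*-distribˡ-sum (χ (T j)) (λ i → P i j)))
                                                    (trans (cong (χ (T j) *_) (cols j)) (*-comm (χ (T j)) (suc k)))) ⟩
  sum (λ j → suc k * χ (T j))                  ≡⟨ *-distribˡ-sum (suc k) (χ ∘ T) ⟨
  suc k * count T                              ∎)
  where
  open ≤-Reasoning
  T : Fin b → Bool
  T = nbhd (support P) S
  entry : ∀ i j → χ (S i) * P i j ≤ χ (T j) * P i j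
  entry i j with 1 ≤? P i j
  ... | yes h = *-monoˡ-≤ (P i j) (χ-mono (λ s → nbhd-intro (support P) S s (does-true (1 ≤? P i j) h)))
  ... | no  h rewrite n<1⇒n≡0 (≰⇒> h) = ≤-reflexive (trans (*-zeroʳ (χ (S i))) (sym (*-zeroʳ (χ (T j)))))

-- Pigeonhole by counting: all n fibres have at most one element and their sizes add up to n, so
-- none is empty.
permutation-column : (f : Fin n → Fin n) → Injective _≡_ _≡_ f → ∀ j → sum (λ i → δ (f i) j) ≡ 1
permutation-column {n} f inj j = ≤-antisym (sum-fibre≤1 f inj j) (≮⇒≥ λ lt → <-irrefl total
  (<-≤-trans (sum-mono-< (sum-fibre≤1 f inj) j lt) (≤-reflexive (sum-const n 1))))
  where
  open ≡-Reasoning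
  total : sum (λ j → sum (λ i → δ (f i) j)) ≡ n * 1
  total = begin
    sum (λ j → sum (λ i → δ (f i) j))  ≡⟨ ∑-comm (λ j i → δ (f i) j) ⟩
    sum (λ i → sum (δ (f i)))          ≡⟨ sum-cong-≗ (λ i → sum-δ₁ (f i)) ⟩
    sum {n} (λ _ → 1)                  ≡⟨ sum-const n 1 ⟩
    n * 1                              ∎

sum-∸ : (f g : Fin n → ℕ) → (∀ i → g i ≤ f i) → sum g ≡ 1 → sum f ≡ suc k → sum (λ i → f i ∸ g i) ≡ k
sum-∸ {n} {k} f g g≤f Σg Σf = +-cancelʳ-≡ 1 _ k (begin
  sum (λ i → f i ∸ g i) + 1      ≡⟨ cong (sum (λ i → f i ∸ g i) +_) Σg ⟨
  sum (λ i → f i ∸ g i) + sum g  ≡⟨ ∑-distrib-+ (λ i → f i ∸ g i) g ⟨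
  sum (λ i → f i ∸ g i + g i)    ≡⟨ sum-cong-≗ (λ i → m∸n+n≡m (g≤f i)) ⟩
  sum f                          ≡⟨ Σf ⟩
  suc k                          ≡⟨ +-comm 1 k ⟩
  k + 1                          ∎)
  where open ≡-Reasoning

-- A perfect matching inside the support is a permutation matrix below `P`; subtracting it lowers
-- every row sum and column sum by one.
birkhoff : ∀ k (P : Fin n → Fin n → ℕ) → (∀ i → sum (P i) ≡ k) → (∀ j → sum (λ i → P i j) ≡ k) →
  Σ (Fin k → Fin n → Fin n) λ σ → (∀ c → Injective _≡_ _≡_ (σ c)) × (∀ i j → P i j ≡ sum (λ c → δ (σ c i) j))
birkhoff zero    P rows cols = (λ ()) , (λ ()) , λ i j → n≤0⇒n≡0 (subst (P i j ≤_) (rows i) (term≤sum (P i) j))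
birkhoff {n} (suc k) P rows cols = σ , σ-injective , decomposition
  where
  matching = hall-matching (support P) (support-hall P rows cols)
  f = proj₁ matching
  f-injective = proj₁ (proj₂ matching)
  δ≤P : ∀ i j → δ (f i) j ≤ P i j
  δ≤P i j with f i ≟ j
  ... | yes refl = true-does (1 ≤? P i (f i)) (proj₂ (proj₂ matching) i)
  ... | no _     = z≤n
  rest = birkhoff k (λ i j → P i j ∸ δ (f i) j)
    (λ i → sum-∸ (P i) (δ (f i)) (δ≤P i) (sum-δ₁ (f i)) (rows i))
    (λ j → sum-∸ (λ i → P i j) (λ i → δ (f i) j) (λ i → δ≤P i j) (permutation-column f f-injective j) (cols j))
  σ : Fin (suc k) → Fin n → Fin n
  σ zero    = f
  σ (suc c) = proj₁ rest c
  σ-injective : ∀ c → Injective _≡_ _≡_ (σ c)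
  σ-injective zero    = f-injective
  σ-injective (suc c) = proj₁ (proj₂ rest) c
  decomposition : ∀ i j → P i j ≡ sum (λ c → δ (σ c i) j)
  decomposition i j = trans (sym (m+[n∸m]≡n (δ≤P i j))) (cong (δ (f i) j +_) (proj₂ (proj₂ rest) i j))

module _ (p : ℕ) (X : Fin a → Fin b → ℕ)
         (rows : ∀ e → sum (X e) ≤ p) (cols : ∀ u → sum (λ e → X e u) ≤ p) where

  private
    -- `X` and its transpose stand off the diagonal; the diagonal blocks hold the weight that each
    -- row or column of `X` lacks to reach `p`. By symmetry only row sums have to be computed.
    block : Fin a ⊎ Fin b → Fin a ⊎ Fin b → ℕ
    block (inj₁ e) (inj₁ e′) = δ e e′ * (p ∸ sum (X e))
    block (inj₁ e) (inj₂ u)  = X e u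
    block (inj₂ u) (inj₁ e)  = X e u
    block (inj₂ u) (inj₂ u′) = δ u u′ * (p ∸ sum (λ e → X e u))

    padded : Fin (a + b) → Fin (a + b) → ℕ
    padded x y = block (splitAt a x) (splitAt a y)

    δ-weight-sym : (w : Fin n → ℕ) → ∀ i j → δ i j * w i ≡ δ j i * w j
    δ-weight-sym w i j with i ≟ j
    ... | yes refl rewrite δ-refl i = refl
    ... | no  i≢j  rewrite δ-≢ (i≢j ∘ sym) = refl

    block-sym : ∀ x y → block x y ≡ block y x
    block-sym (inj₁ e) (inj₁ e′) = δ-weight-sym (λ e → p ∸ sum (X e)) e e′
    block-sym (inj₁ e) (inj₂ u)  = refl
    block-sym (inj₂ u) (inj₁ e)  = refl
    block-sym (inj₂ u) (inj₂ u′) = δ-weight-sym (λ u → p ∸ sum (λ e → X e u)) u u′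

    block-row : ∀ x → sum (λ e → block x (inj₁ e)) + sum (λ u → block x (inj₂ u)) ≡ p
    block-row (inj₁ e) = trans (cong (_+ sum (X e)) (sum-δ e (λ _ → p ∸ sum (X e)))) (m∸n+n≡m (rows e))
    block-row (inj₂ u) = trans (cong (sum (λ e → X e u) +_) (sum-δ u (λ _ → p ∸ sum (λ e → X e u)))) (m+[n∸m]≡n (cols u))

    padded-row : ∀ x → sum (padded x) ≡ p
    padded-row x = trans (sum-++ a (padded x)) (trans
      (cong₂ _+_ (sum-cong-≗ (λ e → cong (block (splitAt a x)) (splitAt-↑ˡ a e b)))
                 (sum-cong-≗ (λ u → cong (block (splitAt a x)) (splitAt-↑ʳ a b u))))
      (block-row (splitAt a x)))

    padded-col : ∀ y → sum (λ x → padded x y) ≡ p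
    padded-col y = trans (sum-cong-≗ (λ x → block-sym (splitAt a x) (splitAt a y))) (padded-row y)

  -- König's edge colouring of the bipartite multigraph X: it is padded to a p-regular symmetric matrix,
  -- which is a sum of p permutation matrices.
  edge-colouring : Σ (Fin p → Fin (a + b) → Fin (a + b)) λ σ → (∀ c → Injective _≡_ _≡_ (σ c)) ×
    (∀ e u → X e u ≡ sum (λ c → δ (σ c (e ↑ˡ b)) (a ↑ʳ u)))
  edge-colouring with birkhoff p padded padded-row padded-col
  ... | σ , inj , eq = σ , inj , λ e u →
    trans (sym (cong₂ block (splitAt-↑ˡ a e b) (splitAt-↑ʳ a b u))) (eq (e ↑ˡ b) (a ↑ʳ u))

-- Decomposition into pseudoforests

den<num : (d : ℚ) → 1ℚ ℚ.< d → den d < num d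
den<num (mkℚ (ℤ.+ p) q _) (ℚ.*<* h) rewrite ℤ.*-identityʳ (ℤ.+ p) | +-identityʳ q = ℤ.drop‿+<+ h
den<num (mkℚ ℤ.-[1+ p ] q _) (ℚ.*<* ())

toℚᵘ-ℕ : ∀ k → toℚᵘ (ℕtoℚ k) ℚᵘ.≃ mkℚᵘ (ℤ.+ k) 0
toℚᵘ-ℕ k = ℚ.toℚᵘ-fromℚᵘ (mkℚᵘ (ℤ.+ k) 0)

-- Denominators are cleared. As `num` is an absolute value, d > 1 serves to exclude a negative
-- numerator.
ℚ≤⇒ℕ≤ : (d : ℚ) → 1ℚ ℚ.< d → ∀ e m → ℕtoℚ e ℚ.≤ d ℚ.* ℕtoℚ m → e * den d ≤ num d * m
ℚ≤⇒ℕ≤ d@(mkℚ (ℤ.+ p) q _) _ e m h = clear (ℚᵘ.≤-respˡ-≃ (toℚᵘ-ℕ e) (ℚᵘ.≤-respʳ-≃ rhs (ℚ.toℚᵘ-mono-≤ h)))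
  where
  rhs : toℚᵘ (d ℚ.* ℕtoℚ m) ℚᵘ.≃ toℚᵘ d ℚᵘ.* mkℚᵘ (ℤ.+ m) 0
  rhs = ℚᵘ.≃-trans (ℚ.toℚᵘ-homo-* d (ℕtoℚ m)) (ℚᵘ.*-congˡ {toℚᵘ d} (toℚᵘ-ℕ m))
  clear : mkℚᵘ (ℤ.+ e) 0 ℚᵘ.≤ mkℚᵘ (ℤ.+ p) q ℚᵘ.* mkℚᵘ (ℤ.+ m) 0 → e * suc q ≤ p * m
  clear (ℚᵘ.*≤* h) = subst₂ _≤_ (cong (e *_) (*-identityʳ (suc q))) (*-identityʳ (p * m))
    (ℤ.drop‿+≤+ (subst₂ ℤ._≤_ (sym (ℤ.pos-* e (suc q * 1)))
      (trans (cong (ℤ._* ℤ.+ 1) (sym (ℤ.pos-* p m))) (sym (ℤ.pos-* (p * m) 1))) h))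
ℚ≤⇒ℕ≤ (mkℚ ℤ.-[1+ p ] q _) (ℚ.*<* ())

sum-allFin : (f : Fin n → ℕ) → ListAction.sum (List.map f (List.allFin n)) ≡ sum f
sum-allFin {n} f = trans (cong ListAction.sum (List.map-tabulate id f)) (go f)
  where
  go : ∀ {n} (f : Fin n → ℕ) → ListAction.sum (List.tabulate f) ≡ sum f
  go {zero}  f = refl
  go {suc n} f = cong (f zero +_) (go (f ∘ suc))

_before_ : Fin m → Fin n → Bool
i before j = ⌊ toℕ i <? toℕ j ⌋

edge : Graph n → Fin n → Fin n → Bool
edge G i j = (i before j) ∧ adj G i j

edges-sum : (G : Graph n) → edges G ≡ sum (λ i → sum (λ j → χ (edge G i j)))
edges-sum {n} G = trans (sum-allFin {n} _) (sum-cong-≗ λ i → trans (sum-allFin {n} _) (sum-cong-≗ λ j → nested (i before j) (adj G i j)))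
  where
  nested : ∀ p q → (if p then χ q else 0) ≡ χ (p ∧ q)
  nested true  q = refl
  nested false q = refl

deg-sum : (G : Graph n) → ∀ i → deg G i ≡ count (adj G i)
deg-sum {n} G i = sum-allFin {n} _

before⇒< : (i : Fin m) (j : Fin n) → i before j ≡ true → toℕ i < toℕ j
before⇒< i j h with toℕ i <? toℕ j
... | yes p = p

<⇒before : (i : Fin m) (j : Fin n) → toℕ i < toℕ j → i before j ≡ true
<⇒before i j p with toℕ i <? toℕ j
... | yes _ = refl
... | no ¬p = contradiction p ¬p

Bool-≡ : ∀ {p q} → (p ≡ true → q ≡ true) → (q ≡ true → p ≡ true) → p ≡ q
Bool-≡ {true}  f g = sym (f refl)
Bool-≡ {false} {true}  f g = g refl
Bool-≡ {false} {false} f g = refl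

StrictlyMonotone : (Fin m → Fin n) → Set
StrictlyMonotone f = ∀ {i j} → toℕ i < toℕ j → toℕ (f i) < toℕ (f j)

monotone-injective : (f : Fin m → Fin n) → StrictlyMonotone f → Injective _≡_ _≡_ f
monotone-injective f mono {i} {j} fi≡fj with <-cmp (toℕ i) (toℕ j)
... | tri< i<j _ _ = contradiction (cong toℕ fi≡fj) (<⇒≢ (mono i<j))
... | tri≈ _ i≡j _ = toℕ-injective i≡j
... | tri> _ _ i>j = contradiction (cong toℕ (sym fi≡fj)) (<⇒≢ (mono i>j))

monotone-before : (f : Fin m → Fin n) → StrictlyMonotone f → ∀ i j → i before j ≡ f i before f j
monotone-before f mono i j = Bool-≡ (λ h → <⇒before (f i) (f j) (mono (before⇒< i j h))) λ h → <⇒before i j (back (before⇒< (f i) (f j) h))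
  where
  back : toℕ (f i) < toℕ (f j) → toℕ i < toℕ j
  back lt with <-cmp (toℕ i) (toℕ j)
  ... | tri< i<j _ _ = i<j
  ... | tri≈ _ i≡j _ = contradiction (cong (toℕ ∘ f) (toℕ-injective i≡j)) (<⇒≢ lt)
  ... | tri> _ _ i>j = contradiction lt (<⇒≯ (mono i>j))

-- The points are listed in increasing order because `edges` counts an edge from its smaller end, so
-- that restriction to the list must respect the order. `reindex` turns sums over the list into sums
-- weighted by the indicator of `P`.
record Enumeration (P : Fin n → Bool) : Set where
  field
    cardinality    : ℕ
    point    : Fin cardinality → Fin n
    holds    : ∀ i → P (point i) ≡ true
    monotone : StrictlyMonotone point
    reindex  : ∀ g → sum (g ∘ point) ≡ sum (λ x → χ (P x) * g x)

open Enumeration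

enumerate : (P : Fin n → Bool) → Enumeration P
enumerate {zero} P = record
  { cardinality = 0 ; point = λ () ; holds = λ () ; monotone = λ { {()} } ; reindex = λ g → refl }
enumerate {suc n} P with enumerate (P ∘ suc) | P zero in eq
... | E | false = record
  { cardinality = cardinality E ; point = suc ∘ point E ; holds = holds E ; monotone = s≤s ∘ monotone E
  ; reindex = λ g → trans (reindex E (g ∘ suc)) (cong (λ b → χ b * g zero + sum (λ x → χ (P (suc x)) * g (suc x))) (sym eq)) }
... | E | true = record
  { cardinality = suc (cardinality E) ; point = point′
  ; holds = λ { zero → eq ; (suc i) → holds E i }
  ; monotone = mono
  ; reindex = λ g → trans (cong₂ _+_ (sym (+-identityʳ (g zero))) (reindex E (g ∘ suc)))
      (cong (λ b → χ b * g zero + sum (λ x → χ (P (suc x)) * g (suc x))) (sym eq)) }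
  where
  point′ : Fin (suc (cardinality E)) → Fin (suc n)
  point′ zero    = zero
  point′ (suc i) = suc (point E i)
  mono : StrictlyMonotone point′
  mono {zero}  {suc j} _         = s≤s z≤n
  mono {suc i} {suc j} (s≤s lt) = s≤s (monotone E lt)

enumeration-size : {P : Fin n → Bool} (E : Enumeration P) → cardinality E ≡ count P
enumeration-size {P = P} E = trans (sym (trans (sum-const (cardinality E) 1) (*-identityʳ (cardinality E))))
  (trans (reindex E (λ _ → 1)) (sum-cong-≗ (λ x → *-identityʳ (χ (P x)))))

point-surjective : {P : Fin n → Bool} (E : Enumeration P) → ∀ x → P x ≡ true → ∃[ i ] point E i ≡ x
point-surjective {P = P} E x h =
  let i , δ≥1 = sum-pos (λ i → δ x (point E i)) (≤-reflexive (sym hits))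
  in i , sym (true-does (x ≟ point E i) (χ-pos δ≥1))
  where
  open ≡-Reasoning
  hits : sum (λ i → δ x (point E i)) ≡ 1
  hits = begin
    sum (δ x ∘ point E)              ≡⟨ reindex E (δ x) ⟩
    sum (λ y → χ (P y) * δ x y)      ≡⟨ sum-cong-≗ (λ y → *-comm (χ (P y)) (δ x y)) ⟩
    sum (λ y → δ x y * χ (P y))      ≡⟨ sum-δ x (χ ∘ P) ⟩
    χ (P x)                          ≡⟨ cong χ h ⟩
    1                                ∎

induced : (H : Graph n) (f : Fin m → Fin n) → Graph m
induced H f = record
  { adj    = λ i j → adj H (f i) (f j)
  ; sym    = λ i j → Graph.sym H (f i) (f j)
  ; irrefl = λ i → irrefl H (f i) }

edges-within : (H : Graph n) {W : Fin n → Bool} (E : Enumeration W) → edges (induced H (point E)) ≡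
  sum (λ u → χ (W u) * sum (λ v → χ (W v) * χ (edge H u v)))
edges-within H {W} E = begin
  edges (induced H f)                                           ≡⟨ edges-sum (induced H f) ⟩
  sum (λ i → sum (λ j → χ (edge (induced H f) i j)))            ≡⟨ sum-cong-≗ (λ i → sum-cong-≗ (λ j →
                                                                     cong (λ b → χ (b ∧ adj H (f i) (f j))) (monotone-before f (monotone E) i j))) ⟩
  sum (λ i → sum (λ j → χ (edge H (f i) (f j))))                ≡⟨ sum-cong-≗ (λ i → reindex E (λ v → χ (edge H (f i) v))) ⟩
  sum (λ i → sum (λ v → χ (W v) * χ (edge H (f i) v)))          ≡⟨ reindex E (λ u → sum (λ v → χ (W v) * χ (edge H u v))) ⟩
  sum (λ u → χ (W u) * sum (λ v → χ (W v) * χ (edge H u v)))    ∎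
  where
  open ≡-Reasoning
  f = point E

density-count : (d : ℚ) → 1ℚ ℚ.< d → (H : Graph n) → DensityAtMost d H → (W : Fin n → Bool) →
  den d * sum (λ u → χ (W u) * sum (λ v → χ (W v) * χ (edge H u v))) ≤ num d * count W
density-count d 1<d H dense W = begin
  den d * sum (λ u → χ (W u) * sum (λ v → χ (W v) * χ (edge H u v)))  ≡⟨ cong (den d *_) (edges-within H E) ⟨
  den d * edges (induced H (point E))                                 ≡⟨ *-comm (den d) _ ⟩
  edges (induced H (point E)) * den d                                 ≤⟨ ℚ≤⇒ℕ≤ d 1<d (edges (induced H (point E))) (cardinality E)
                                                                           (dense (cardinality E) (induced H (point E))
                                                                             (point E , monotone-injective (point E) (monotone E) , λ i j h → h)) ⟩
  num d * cardinality E                                                     ≡⟨ cong (num d *_) (enumeration-size E) ⟩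
  num d * count W                                                     ∎
  where
  open ≤-Reasoning
  E = enumerate W

module _ (I : Fin a → Fin b → Bool) (q p : ℕ) (hall : ∀ S → q * count S ≤ p * count (nbhd I S)) where

  private
    copyˡ : Fin a → Fin q → Fin (a * q)
    copyˡ = combine
    copyʳ : Fin b → Fin p → Fin (b * p)
    copyʳ = combine
    left : Fin (a * q) → Fin a
    left x = proj₁ (remQuot q x)
    right : Fin (b * p) → Fin b
    right y = proj₁ (remQuot p y)

    copies : Fin (a * q) → Fin (b * p) → Bool
    copies x y = I (left x) (right y)

    left-combine : ∀ e k → left (copyˡ e k) ≡ e
    left-combine e k = cong proj₁ (remQuot-combine e k)

    right-combine : ∀ u l → right (copyʳ u l) ≡ u
    right-combine u l = cong proj₁ (remQuot-combine u l)

    -- A set of copies may be completed to `S′`, all copies of the elements it touches: this can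
    -- only enlarge the set and adds no neighbours. For completed sets the condition is the weighted
    -- hypothesis `hall`.
    copies-hall : Hall copies
    copies-hall S = begin
      count S                                                         ≡⟨ sum-combine a (χ ∘ S) ⟩
      sum (λ e → sum {q} (λ k → χ (S (copyˡ e k))))                 ≤⟨ sum-mono (λ e → sum-mono (λ k → χ-mono (anyᵇ-intro (λ k → S (copyˡ e k)) k))) ⟩
      sum (λ e → sum {q} (λ k → χ (S′ e)))                            ≡⟨ sum-cong-≗ (λ e → sum-const q (χ (S′ e))) ⟩
      sum (λ e → q * χ (S′ e))                                        ≡⟨ *-distribˡ-sum q (χ ∘ S′) ⟨
      q * count S′                                                    ≤⟨ hall S′ ⟩
      p * count (nbhd I S′)                                           ≡⟨ *-distribˡ-sum p (χ ∘ nbhd I S′) ⟩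
      sum (λ u → p * χ (nbhd I S′ u))                                 ≡⟨ sum-cong-≗ (λ u → sum-const p (χ (nbhd I S′ u))) ⟨
      sum (λ u → sum {p} (λ l → χ (nbhd I S′ u)))                     ≤⟨ sum-mono (λ u → sum-mono (λ l → χ-mono (lift u l))) ⟩
      sum (λ u → sum {p} (λ l → χ (nbhd copies S (copyʳ u l))))     ≡⟨ sum-combine b (χ ∘ nbhd copies S) ⟨
      count (nbhd copies S)                                           ∎
      where
      open ≤-Reasoning
      S′ : Fin a → Bool
      S′ e = anyᵇ (λ k → S (copyˡ e k))
      lift : ∀ u l → nbhd I S′ u ≡ true → nbhd copies S (copyʳ u l) ≡ true
      lift u l h =
        let e , s , i = nbhd-elim I S′ h
            k , s′    = anyᵇ-elim (λ k → S (copyˡ e k)) s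
        in nbhd-intro copies S s′ (trans (cong₂ I (left-combine e k) (right-combine u l)) i)

  -- A matching between `q` copies of every left element and `p` copies of every right element, with
  -- `X e u` the number of copies of `e` matched to copies of `u`.
  transport : Σ (Fin a → Fin b → ℕ) λ X →
    (∀ e u → 1 ≤ X e u → I e u ≡ true) × (∀ e → sum (X e) ≡ q) × (∀ u → sum (λ e → X e u) ≤ p)
  transport with hall-matching copies copies-hall
  ... | f , f-injective , matched = X , supported , rows , cols
    where
    X : Fin a → Fin b → ℕ
    X e u = sum {q} (λ k → δ (right (f (copyˡ e k))) u)
    supported : ∀ e u → 1 ≤ X e u → I e u ≡ true
    supported e u h =
      let k , δ≥1 = sum-pos (λ k → δ (right (f (copyˡ e k))) u) h
      in trans (cong₂ I (sym (left-combine e k)) (sym (true-does (right (f (copyˡ e k)) ≟ u) (χ-pos δ≥1))))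
               (matched (copyˡ e k))
    rows : ∀ e → sum (X e) ≡ q
    rows e = begin
      sum (X e)                                             ≡⟨ ∑-comm {b} {q} (λ u k → δ (right (f (copyˡ e k))) u) ⟩
      sum {q} (λ k → sum (δ (right (f (copyˡ e k)))))     ≡⟨ sum-cong-≗ {q} (λ k → sum-δ₁ (right (f (copyˡ e k)))) ⟩
      sum {q} (λ k → 1)                                     ≡⟨ sum-const q 1 ⟩
      q * 1                                                 ≡⟨ *-identityʳ q ⟩
      q                                                     ∎
      where open ≡-Reasoning
    cols : ∀ u → sum (λ e → X e u) ≤ p
    cols u = begin
      sum (λ e → X e u)                                     ≡⟨ sum-combine a (λ x → δ (right (f x)) u) ⟨
      sum (λ x → δ (right (f x)) u)                         ≤⟨ sum-mono (λ x → hits x) ⟩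
      sum (λ x → sum {p} (λ l → δ (f x) (copyʳ u l)))     ≡⟨ ∑-comm {n = p} (λ x l → δ (f x) (copyʳ u l)) ⟩
      sum {p} (λ l → sum (λ x → δ (f x) (copyʳ u l)))     ≤⟨ sum-mono {p} (λ l → sum-fibre≤1 f f-injective (copyʳ u l)) ⟩
      sum {p} (λ l → 1)                                     ≡⟨ sum-const p 1 ⟩
      p * 1                                                 ≡⟨ *-identityʳ p ⟩
      p                                                     ∎
      where
      open ≤-Reasoning
      hits : ∀ x → δ (right (f x)) u ≤ sum {p} (λ l → δ (f x) (copyʳ u l))
      hits x with right (f x) ≟ u
      ... | no _ = z≤n
      ... | yes refl = ≤-trans (≤-reflexive (sym (cong χ
                         (does-true (f x ≟ copyʳ (right (f x)) (proj₂ (remQuot {b} p (f x)))) (sym (combine-remQuot {b} p (f x)))))))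
                         (term≤sum (λ l → δ (f x) (copyʳ (right (f x)) l)) (proj₂ (remQuot {b} p (f x))))

edgeAt : Graph n → Fin (n * n) → Bool
edgeAt {n} H x = uncurry (edge H) (remQuot n x)

module Edges (H : Graph n) (E : Enumeration (edgeAt H)) where

  source target : Fin (cardinality E) → Fin n
  source e = proj₁ (remQuot n (point E e))
  target e = proj₂ (remQuot {n} n (point E e))

  endpoint : Fin (cardinality E) → Fin n → Bool
  endpoint e u = does (source e ≟ u) ∨ does (target e ≟ u)

  endpoint-elim : ∀ e u → endpoint e u ≡ true → source e ≡ u ⊎ target e ≡ u
  endpoint-elim e u h = [ inj₁ ∘ true-does (source e ≟ u) , inj₂ ∘ true-does (target e ≟ u) ]′ (∨-true {does (source e ≟ u)} h)

  adjacent-ends : ∀ e → adj H (source e) (target e) ≡ true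
  adjacent-ends e = proj₂ (∧-true {source e before target e} (holds E e))

  -- The edges in `S` all lie in the subgraph induced on the set `W` of their ends, whose number of
  -- edges is bounded by the density.
  endpoints-hall : (d : ℚ) → 1ℚ ℚ.< d → DensityAtMost d H → ∀ S → den d * count S ≤ num d * count (nbhd endpoint S)
  endpoints-hall d 1<d dense S = ≤-trans (*-monoʳ-≤ (den d) spanned) (density-count d 1<d H dense W)
    where
    open ≤-Reasoning
    W = nbhd endpoint S
    pair : Fin n → Fin n → Fin (n * n)
    pair = combine
    within : Fin (n * n) → ℕ
    within x = χ (W (proj₁ (remQuot {n} n x))) * χ (W (proj₂ (remQuot {n} n x)))
    inside : ∀ e → χ (S e) ≤ within (point E e)
    inside e with S e in s
    ... | false = z≤n
    ... | true  = ≤-reflexive (sym (cong₂ (λ b c → χ b * χ c)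
      (nbhd-intro endpoint S s (cong (_∨ does (target e ≟ source e)) (does-true (source e ≟ source e) refl)))
      (nbhd-intro endpoint S s (∨-trueʳ (does (source e ≟ target e)) (does-true (target e ≟ target e) refl)))))
    at : ∀ u v → χ (edgeAt H (pair u v)) * within (pair u v) ≡ χ (W u) * (χ (W v) * χ (edge H u v))
    at u v = trans (cong (λ (u , v) → χ (edge H u v) * (χ (W u) * χ (W v))) (remQuot-combine u v)) (
      trans (*-comm (χ (edge H u v)) (χ (W u) * χ (W v))) (*-assoc (χ (W u)) (χ (W v)) (χ (edge H u v))))
    spanned : count S ≤ sum (λ u → χ (W u) * sum (λ v → χ (W v) * χ (edge H u v)))
    spanned = begin
      count S                                                                       ≤⟨ sum-mono inside ⟩
      sum (within ∘ point E)                                                        ≡⟨ reindex E within ⟩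
      sum (λ x → χ (edgeAt H x) * within x)                                           ≡⟨ sum-combine n (λ x → χ (edgeAt H x) * within x) ⟩
      sum (λ u → sum {n} (λ v → χ (edgeAt H (pair u v)) * within (pair u v)))   ≡⟨ sum-cong-≗ (λ u → sum-cong-≗ (at u)) ⟩
      sum (λ u → sum {n} (λ v → χ (W u) * (χ (W v) * χ (edge H u v))))              ≡⟨ sum-cong-≗ (λ u →
                                                                                           *-distribˡ-sum (χ (W u)) (λ v → χ (W v) * χ (edge H u v))) ⟨
      sum (λ u → χ (W u) * sum (λ v → χ (W v) * χ (edge H u v)))                    ∎

  other : Fin (cardinality E) → Fin n → Fin n
  other e u with source e ≟ u
  ... | yes _ = target e
  ... | no  _ = source e

  other-adjacent : ∀ e u → endpoint e u ≡ true → adj H u (other e u) ≡ true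
  other-adjacent e u h with source e ≟ u | endpoint-elim e u h
  ... | yes refl | _         = adjacent-ends e
  ... | no ¬s    | inj₁ s    = contradiction s ¬s
  ... | no _     | inj₂ refl = trans (Graph.sym H (target e) (source e)) (adjacent-ends e)

  edge-index : ∀ u v → edge H u v ≡ true → ∃[ e ] (source e ≡ u × target e ≡ v)
  edge-index u v h =
    let e , pe = point-surjective E (combine u v) (trans (cong (uncurry (edge H)) (remQuot-combine u v)) h)
        ends   = trans (cong (remQuot n) pe) (remQuot-combine u v)
    in e , cong proj₁ ends , cong proj₂ ends

  module Parents (p q : ℕ) (X : Fin (cardinality E) → Fin n → ℕ)
    (X-supported : ∀ e u → 1 ≤ X e u → endpoint e u ≡ true) (X-rows : ∀ e → sum (X e) ≡ q)
    (σ : Fin p → Fin (cardinality E + n) → Fin (cardinality E + n)) (σ-injective : ∀ c → Injective _≡_ _≡_ (σ c))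
    (X-decomposition : ∀ e u → X e u ≡ sum (λ c → δ (σ c (e ↑ˡ n)) (cardinality E ↑ʳ u))) where

    colours : Fin p → Fin (cardinality E) → Fin n → ℕ
    colours c e u = δ (σ c (e ↑ˡ n)) (cardinality E ↑ʳ u)

    coloured-endpoint : ∀ c e u → σ c (e ↑ˡ n) ≡ cardinality E ↑ʳ u → endpoint e u ≡ true
    coloured-endpoint c e u h = X-supported e u (begin
      1                                ≡⟨ cong χ (does-true (σ c (e ↑ˡ n) ≟ (cardinality E ↑ʳ u)) h) ⟨
      colours c e u                    ≤⟨ term≤sum (λ c → colours c e u) c ⟩
      sum (λ c → colours c e u)        ≡⟨ X-decomposition e u ⟨
      X e u                            ∎)
      where open ≤-Reasoning

    outEdge? : ∀ c u → Dec (∃[ e ] σ c (e ↑ˡ n) ≡ cardinality E ↑ʳ u)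
    outEdge? c u = any? (λ e → σ c (e ↑ˡ n) ≟ (cardinality E ↑ʳ u))

    step : ∀ {c u} → Dec (∃[ e ] σ c (e ↑ˡ n) ≡ cardinality E ↑ʳ u) → Fin n
    step {u = u} (yes (e , _)) = other e u
    step {u = u} (no _)        = u

    step-adjacent : ∀ c u (D : Dec (∃[ e ] σ c (e ↑ˡ n) ≡ cardinality E ↑ʳ u)) → step D ≡ u ⊎ adj H u (step D) ≡ true
    step-adjacent c u (yes (e , h)) = inj₂ (other-adjacent e u (coloured-endpoint c e u h))
    step-adjacent c u (no _)        = inj₁ refl

    step-other : ∀ c e u → σ c (e ↑ˡ n) ≡ cardinality E ↑ʳ u → (D : Dec (∃[ e ] σ c (e ↑ˡ n) ≡ cardinality E ↑ʳ u)) → step D ≡ other e u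
    step-other c e u h (yes (e′ , h′)) = cong (λ e → other e u) (↑ˡ-injective n e′ e (σ-injective c (trans h′ (sym h))))
    step-other c e u h (no ¬∃)         = contradiction (e , h) ¬∃

    -- Since `σ c` is injective, at most one edge is assigned to `u` in colour `c`. Orienting it
    -- from `u` to its other end gives out-degree at most one, that is, a pseudoforest; a vertex
    -- with no such edge is made a fixed point.
    parent : Fin p → Fin n → Fin n
    parent c u = step (outEdge? c u)

    parent-adjacent : ∀ c u → parent c u ≡ u ⊎ adj H u (parent c u) ≡ true
    parent-adjacent c u = step-adjacent c u (outEdge? c u)

    linked : Fin n → Fin n → Fin p → Bool
    linked u v c = does (parent c u ≟ v) ∨ does (parent c v ≟ u)

    ≤χ : ∀ {s b} → s ≤ 1 → (1 ≤ s → b ≡ true) → s ≤ χ b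
    ≤χ {zero}        _         _ = z≤n
    ≤χ {suc zero}    _         h rewrite h ≤-refl = ≤-refl
    ≤χ {suc (suc _)} (s≤s ()) _

    other-end : ∀ e w → endpoint e w ≡ true → (w ≡ source e × other e w ≡ target e) ⊎ (w ≡ target e × other e w ≡ source e)
    other-end e w h with source e ≟ w | endpoint-elim e w h
    ... | yes s | _      = inj₁ (sym s , refl)
    ... | no ¬s | inj₁ s = contradiction s ¬s
    ... | no _  | inj₂ t = inj₂ (sym t , refl)

    linked-edge : ∀ c e w → σ c (e ↑ˡ n) ≡ cardinality E ↑ʳ w → linked (source e) (target e) c ≡ true
    linked-edge c e w h with other-end e w (coloured-endpoint c e w h) | step-other c e w h (outEdge? c w)
    ... | inj₁ (refl , o) | p = cong (_∨ does (parent c (target e) ≟ source e)) (does-true (parent c (source e) ≟ target e) (trans p o))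
    ... | inj₂ (refl , o) | p = ∨-trueʳ (does (parent c (source e) ≟ target e)) (does-true (parent c (target e) ≟ source e) (trans p o))

    -- The `q` shares of an edge have different colours, because `σ c` sends the edge to one place
    -- only. Every one of these colours makes one end of the edge the parent of the other.
    linked-ends : ∀ e → q ≤ count (linked (source e) (target e))
    linked-ends e = begin
      q                                        ≡⟨ X-rows e ⟨
      sum (X e)                                    ≡⟨ sum-cong-≗ (X-decomposition e) ⟩
      sum (λ w → sum (λ c → colours c e w))        ≡⟨ ∑-comm (λ w c → colours c e w) ⟩
      sum (λ c → sum (λ w → colours c e w))        ≤⟨ sum-mono (λ c → ≤χ (single c) (hit c)) ⟩
      count (linked (source e) (target e))         ∎
      where
      open ≤-Reasoning
      single : ∀ c → sum (λ w → colours c e w) ≤ 1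
      single c = ≤-trans (≤-reflexive (sum-cong-≗ (λ w → δ-sym (σ c (e ↑ˡ n)) (cardinality E ↑ʳ w))))
        (sum-fibre≤1 (cardinality E ↑ʳ_) (λ {i} {j} → ↑ʳ-injective (cardinality E) i j) (σ c (e ↑ˡ n)))
      hit : ∀ c → 1 ≤ sum (λ w → colours c e w) → linked (source e) (target e) c ≡ true
      hit c h = let w , δ≥1 = sum-pos (colours c e) h
                in linked-edge c e w (true-does (σ c (e ↑ˡ n) ≟ (cardinality E ↑ʳ w)) (χ-pos δ≥1))

    linked-edges : ∀ u v → edge H u v ≡ true → q ≤ count (linked u v)
    linked-edges u v h with edge-index u v h
    ... | e , refl , refl = linked-ends e

    linked-count : ∀ u v → adj H u v ≡ true → q ≤ count (linked u v)
    linked-count u v uv with <-cmp (toℕ u) (toℕ v)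
    ... | tri< u<v _ _ = linked-edges u v (cong₂ _∧_ (<⇒before u v u<v) uv)
    ... | tri≈ _ u≡v _ with toℕ-injective u≡v
    ...   | refl = case trans (sym uv) (irrefl H u) of λ ()
    linked-count u v uv | tri> _ _ v<u =
      ≤-trans (linked-edges v u (cong₂ _∧_ (<⇒before v u v<u) (trans (Graph.sym H v u) uv)))
        (≤-reflexive (sum-cong-≗ (λ c → cong χ (Bool.∨-comm (does (parent c v ≟ u)) (does (parent c u ≟ v))))))

-- Each π c is the parent map of a pseudoforest; its fixed points are the vertices without a parent.
pseudoforests : (d : ℚ) → 1ℚ ℚ.< d → (H : Graph n) → DensityAtMost d H →
  Σ (Fin (num d) → Fin n → Fin n) λ π → (∀ c u → π c u ≡ u ⊎ adj H u (π c u) ≡ true) ×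
    (∀ u v → adj H u v ≡ true → den d ≤ count (λ c → does (π c u ≟ v) ∨ does (π c v ≟ u)))
pseudoforests d 1<d H dense =
  let E = enumerate (edgeAt H)
      open Edges H E
      X , X-supported , X-rows , X-cols = transport endpoint (den d) (num d) (endpoints-hall d 1<d dense)
      σ , σ-injective , X-decomposition = edge-colouring (num d) X
        (λ e → subst (_≤ num d) (sym (X-rows e)) (<⇒≤ (den<num d 1<d))) X-cols
      open Parents (num d) (den d) X X-supported X-rows σ σ-injective X-decomposition
  in parent , parent-adjacent , linked-count

-- Words read along a pseudoforest

search : (Fin n → Bool) → Maybe (Fin n)
search {zero}  P = nothing
search {suc n} P = if P zero then just zero else Maybe.map suc (search (P ∘ suc))

search-sound : (P : Fin n → Bool) → ∀ {x} → search P ≡ just x → P x ≡ true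
search-sound {suc n} P eq with P zero in p
search-sound {suc n} P refl | true = p
search-sound {suc n} P eq | false with search (P ∘ suc) in s
search-sound {suc n} P refl | false | just x = search-sound (P ∘ suc) s

search-complete : (P : Fin n → Bool) → ∀ x → P x ≡ true → ∃[ y ] search P ≡ just y
search-complete {suc n} P x       h with P zero in p
search-complete {suc n} P x       h | true  = zero , refl
search-complete {suc n} P zero    h | false = case trans (sym p) h of λ ()
search-complete {suc n} P (suc x) h | false with search-complete (P ∘ suc) x h
... | y , eq rewrite eq = suc y , refl

search-cong : {P Q : Fin n → Bool} → (∀ x → P x ≡ Q x) → search P ≡ search Q
search-cong {zero}          h = refl
search-cong {suc n} {P} {Q} h rewrite h zero | search-cong {P = P ∘ suc} {Q ∘ suc} (h ∘ suc) = refl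

module _ {A : Set} (f : A → A) where

  iterate-+ : ∀ x m n → iterate f x (m + n) ≡ iterate f (iterate f x m) n
  iterate-+ x zero    n = refl
  iterate-+ x (suc m) n = iterate-+ (f x) m n

  iterate-suc : ∀ x n → iterate f (f x) n ≡ f (iterate f x n)
  iterate-suc x zero    = refl
  iterate-suc x (suc n) = iterate-suc (f x) n

-- The walk u, π u, π² u, … is read as a sequence of states. A vertex on a π-cycle of length at most L is
-- replaced by a representative of its cycle, where the walk then stays while a counter increases.
module Walks (π : Fin n → Fin n) (l : ℕ) where

  L : ℕ
  L = suc l

  -- The case `c` = 0 consists of the fixed points of `π`, so vertices without a parent count as
  -- cycles of length one. Longer cycles than `L` may remain, as a walk of `L` states does not get
  -- around them.
  Cyclic : Fin n → Set
  Cyclic v = ∃[ c ] (c < L × iterate π v (suc c) ≡ v)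

  cyclic? : ∀ v → Dec (Cyclic v)
  cyclic? v = anyUpTo? (λ c → iterate π v (suc c) ≟ v) L

  Orbit : Fin n → Fin n → Set
  Orbit v u = ∃[ a ] (a < L × iterate π v a ≡ u)

  orbit? : ∀ v u → Dec (Orbit v u)
  orbit? v u = anyUpTo? (λ a → iterate π v a ≟ u) L

  cyclic-step : ∀ {v} → Cyclic v → Cyclic (π v)
  cyclic-step {v} (c , c<L , eq) = c , c<L , trans (iterate-suc π (π v) c) (cong π eq)

  cyclic-iterate : ∀ {v} a → Cyclic v → Cyclic (iterate π v a)
  cyclic-iterate zero    h = h
  cyclic-iterate (suc a) h = cyclic-iterate a (cyclic-step h)

  orbit-step : ∀ {v u} → Cyclic v → Orbit v u → Orbit (π v) u
  orbit-step (c , c<L , eq) (zero  , _ , refl) = c , c<L , eq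
  orbit-step _              (suc a , lt , eq)  = a , <-trans (n<1+n a) lt , eq

  orbit-back : ∀ {v u} → Cyclic v → Orbit (π v) u → Orbit v u
  orbit-back {v} {u} (c , c<L , cyc) (a , a<L , eq) with suc a <? L
  ... | yes lt = suc a , lt , eq
  -- Here `suc a` equals `L` and is out of range as a witness; one full turn of `suc c` steps is
  -- dropped.
  ... | no ¬lt = L ∸ suc c , s≤s (m∸n≤m l c) , (begin
    iterate π v (L ∸ suc c)                      ≡⟨ cong (λ x → iterate π x (L ∸ suc c)) cyc ⟨
    iterate π (iterate π v (suc c)) (L ∸ suc c)  ≡⟨ iterate-+ π v (suc c) (L ∸ suc c) ⟨
    iterate π v (suc c + (L ∸ suc c))            ≡⟨ cong (iterate π v) (trans (m+[n∸m]≡n c<L) (≤-antisym (≮⇒≥ ¬lt) a<L)) ⟩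
    iterate π v (suc a)                          ≡⟨ eq ⟩
    u                                            ∎)
    where open ≡-Reasoning

  -- The least vertex on the cycle of a cyclic `v`. The result of `search` depends only on the
  -- values of the predicate, so vertices with the same orbit agree; the default `v` never occurs,
  -- as `v` lies in its own orbit.
  representative : Fin n → Fin n
  representative v = fromMaybe v (search (λ u → does (orbit? v u)))

  representative-orbit : ∀ v → Orbit v (representative v)
  representative-orbit v with search-complete (λ u → does (orbit? v u)) v (does-true (orbit? v v) (0 , s≤s z≤n , refl))
  ... | u , eq = subst (Orbit v ∘ fromMaybe v) (sym eq) (true-does (orbit? v u) (search-sound (λ u → does (orbit? v u)) eq))

  representative-step : ∀ {v} → Cyclic v → representative (π v) ≡ representative v
  representative-step {v} h with search-complete (λ u → does (orbit? v u)) v (does-true (orbit? v v) (0 , s≤s z≤n , refl))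
  ... | u , eq = trans (cong (fromMaybe (π v)) (trans (search-cong same) eq)) (cong (fromMaybe v) (sym eq))
    where
    same : ∀ u → does (orbit? (π v) u) ≡ does (orbit? v u)
    same u = Bool-≡ (does-true (orbit? v u) ∘ orbit-back h ∘ true-does (orbit? (π v) u))
                    (does-true (orbit? (π v) u) ∘ orbit-step h ∘ true-does (orbit? v u))

  private
    norm′ : ∀ v → Dec (Cyclic v) → Fin n
    norm′ v (yes _) = representative v
    norm′ v (no _)  = v

  norm : Fin n → Fin n
  norm v = norm′ v (cyclic? v)

  norm-cyclic : ∀ {v} → Cyclic v → norm v ≡ representative v
  norm-cyclic {v} h with cyclic? v
  ... | yes _ = refl
  ... | no ¬h = contradiction h ¬h

  State : Set
  State = Fin n × ℕ

  private
    move′ : ∀ v → ℕ → Dec (Cyclic v) → State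
    move′ v k (yes _) = v , suc k
    move′ v k (no _)  = norm (π v) , 0

  move : State → State
  move (v , k) = move′ v k (cyclic? v)

  move-cyclic : ∀ {v} k → Cyclic v → move (v , k) ≡ (v , suc k)
  move-cyclic {v} k h with cyclic? v
  ... | yes _ = refl
  ... | no ¬h = contradiction h ¬h

  move-acyclic : ∀ {v} k → ¬ Cyclic v → move (v , k) ≡ (norm (π v) , 0)
  move-acyclic {v} k h with cyclic? v
  ... | yes c = contradiction c h
  ... | no _  = refl

  start : Fin n → State
  start v = norm v , 0

  state : Fin n → ℕ → State
  state v = iterate move (start v)

  -- The source of all links between words: on a short cycle a vertex and its parent have the same
  -- representative, and off it the walk of the parent is the walk of the vertex with its first
  -- state removed.
  start-parent : ∀ v → start (π v) ≡ start v ⊎ start (π v) ≡ move (start v)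
  start-parent v with cyclic? v in eq
  ... | yes h = inj₁ (cong (_, 0) (trans (norm-cyclic (cyclic-step h)) (representative-step h)))
  ... | no ¬h = inj₂ (sym (move-acyclic 0 ¬h))

  iterate-move-cyclic : ∀ {v} → Cyclic v → ∀ k d → iterate move (v , k) d ≡ (v , k + d)
  iterate-move-cyclic {v} h k zero    = cong (v ,_) (sym (+-identityʳ k))
  iterate-move-cyclic {v} h k (suc d) = begin
    iterate move (move (v , k)) d  ≡⟨ cong (λ s → iterate move s d) (move-cyclic k h) ⟩
    iterate move (v , suc k) d     ≡⟨ iterate-move-cyclic h (suc k) d ⟩
    (v , suc k + d)                ≡⟨ cong (v ,_) (+-suc k d) ⟨
    (v , k + suc d)                ∎
    where open ≡-Reasoning

  -- The invariant after `j` moves. Before reaching a short cycle the walk has followed `π` exactly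
  -- `j` times; afterwards the jump to the representative may have cost up to `L` further steps.
  Position : Fin n → ℕ → State → Set
  Position v j (u , k) = k ≤ j × ((¬ Cyclic u × u ≡ iterate π v j) ⊎ (Cyclic u × ∃[ a ] (a ≤ j + L × u ≡ iterate π v a)))

  norm-position : ∀ v j → Position v j (norm (iterate π v j) , 0)
  norm-position v j with cyclic? (iterate π v j)
  ... | no ¬h = z≤n , inj₁ (¬h , refl)
  ... | yes h with representative-orbit (iterate π v j)
  ...   | a , a<L , eq = z≤n , inj₂ (subst Cyclic eq (cyclic-iterate a h) , j + a , +-monoʳ-≤ j (<⇒≤ a<L) ,
                                     trans (sym eq) (sym (iterate-+ π v j a)))

  move-position : ∀ v j s → Position v j s → Position v (suc j) (move s)
  move-position v j (u , k) (k≤j , inj₁ (¬h , u≡)) = subst (Position v (suc j)) (sym (move-acyclic k ¬h))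
    (subst (λ x → Position v (suc j) (norm x , 0)) (trans (iterate-suc π v j) (cong π (sym u≡))) (norm-position v (suc j)))
  move-position v j (u , k) (k≤j , inj₂ (h , a , a≤ , u≡)) = subst (Position v (suc j)) (sym (move-cyclic k h))
    (s≤s k≤j , inj₂ (h , a , m≤n⇒m≤1+n a≤ , u≡))

  state-position : ∀ v j → Position v j (state v j)
  state-position v zero    = norm-position v zero
  state-position v (suc j) = subst (Position v (suc j)) (sym (iterate-suc move (start v) j))
    (move-position v j (state v j) (state-position v j))

  state-reachable : ∀ v {j} → j < L → ∃[ a ] (a ≤ L + L × proj₁ (state v j) ≡ iterate π v a)
  state-reachable v {j} j<L with state-position v j
  ... | _ , inj₁ (_ , eq)          = j , ≤-trans (<⇒≤ j<L) (m≤m+n L L) , eq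
  ... | _ , inj₂ (_ , a , a≤ , eq) = a , ≤-trans a≤ (+-monoˡ-≤ L (<⇒≤ j<L)) , eq

  -- On a representative the counter distinguishes the two times. Elsewhere a repetition would close
  -- a cycle of length `suc d`, at most `L`, through a vertex that is not cyclic.
  state-later : ∀ v i d → suc d + i < L → state v i ≢ state v (i + suc d)
  state-later v i d lt eq = go (state v i) refl (state-position v i)
    where
    open ≡-Reasoning
    go : ∀ s → state v i ≡ s → ¬ Position v i s
    go (u , k) si (_ , inj₂ (h , _)) = <-irrefl (cong proj₂ same) (m<m+n k (s≤s z≤n))
      where
      same : (u , k) ≡ (u , k + suc d)
      same = begin
        (u , k)                            ≡⟨ si ⟨
        state v i                          ≡⟨ eq ⟩
        state v (i + suc d)                ≡⟨ iterate-+ move (start v) i (suc d) ⟩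
        iterate move (state v i) (suc d)   ≡⟨ cong (λ s → iterate move s (suc d)) si ⟩
        iterate move (u , k) (suc d)       ≡⟨ iterate-move-cyclic h k (suc d) ⟩
        (u , k + suc d)                    ∎
    go (u , k) si (_ , inj₁ (¬h , u≡)) with subst (Position v (i + suc d)) (trans (sym eq) si) (state-position v (i + suc d))
    ... | _ , inj₂ (h , _)   = ¬h h
    ... | _ , inj₁ (_ , u≡′) = ¬h (d , ≤-trans (s≤s (≤-trans (m≤m+n d i) (n≤1+n (d + i)))) lt , (begin
      iterate π u (suc d)                  ≡⟨ cong (λ x → iterate π x (suc d)) u≡ ⟩
      iterate π (iterate π v i) (suc d)    ≡⟨ iterate-+ π v i (suc d) ⟨
      iterate π v (i + suc d)              ≡⟨ u≡′ ⟨
      u                                    ∎))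

  state-injective : ∀ v {i j} → i < L → j < L → state v i ≡ state v j → i ≡ j
  state-injective v {i} {j} i<L j<L eq with <-cmp i j
  ... | tri≈ _ i≡j _ = i≡j
  ... | tri< i<j _ _ = contradiction (trans eq (cong (state v) (sym (m+[n∸m]≡n i<j)))) (λ e →
    state-later v i (j ∸ suc i) (≤-trans (s≤s (≤-reflexive (trans (cong suc (+-comm (j ∸ suc i) i)) (m+[n∸m]≡n i<j)))) j<L)
      (trans e (cong (state v) (sym (+-suc i (j ∸ suc i))))))
  ... | tri> _ _ j<i = contradiction (trans (sym eq) (cong (state v) (sym (m+[n∸m]≡n j<i)))) (λ e →
    state-later v j (i ∸ suc j) (≤-trans (s≤s (≤-reflexive (trans (cong suc (+-comm (i ∸ suc j) j)) (m+[n∸m]≡n j<i)))) i<L)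
      (trans e (cong (state v) (sym (+-suc j (i ∸ suc j))))))

private
  variable
    A E M : ℕ

-- First-moment count

-- The sum over all A^M choices of letters, an unnormalised expectation.
total : ∀ M → (Vec (Fin A) M → ℕ) → ℕ
total zero    g = g []
total (suc M) g = sum (λ c → total M (λ ω → g (c ∷ ω)))

total-cong : ∀ M {f g : Vec (Fin A) M → ℕ} → (∀ ω → f ω ≡ g ω) → total M f ≡ total M g
total-cong zero    h = h []
total-cong (suc M) h = sum-cong-≗ (λ c → total-cong M (λ ω → h (c ∷ ω)))

total-mono : ∀ M {f g : Vec (Fin A) M → ℕ} → (∀ ω → f ω ≤ g ω) → total M f ≤ total M g
total-mono zero    h = h []
total-mono (suc M) h = sum-mono (λ c → total-mono M (λ ω → h (c ∷ ω)))

total-const : ∀ M k → total {A} M (λ _ → k) ≡ A ^ M * k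
total-const {A} zero    k = sym (*-identityˡ k)
total-const {A} (suc M) k = begin
  sum {A} (λ _ → total {A} M (λ _ → k))  ≡⟨ sum-cong-≗ {A} (λ _ → total-const M k) ⟩
  sum {A} (λ _ → A ^ M * k)              ≡⟨ sum-const A (A ^ M * k) ⟩
  A * (A ^ M * k)                        ≡⟨ *-assoc A (A ^ M) k ⟨
  A ^ suc M * k                          ∎
  where open ≡-Reasoning

total-* : ∀ M k (g : Vec (Fin A) M → ℕ) → k * total M g ≡ total M (λ ω → k * g ω)
total-* zero    k g = refl
total-* (suc M) k g = trans (*-distribˡ-sum k (λ c → total M (λ ω → g (c ∷ ω))))
  (sum-cong-≗ (λ c → total-* M k (λ ω → g (c ∷ ω))))

term≤total : ∀ M (g : Vec (Fin A) M → ℕ) ω → g ω ≤ total M g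
term≤total zero    g []      = ≤-refl
term≤total (suc M) g (c ∷ ω) =
  ≤-trans (term≤total M (λ ω → g (c ∷ ω)) ω) (term≤sum (λ c → total M (λ ω → g (c ∷ ω))) c)

total-sum : ∀ M (g : Fin n → Vec (Fin A) M → ℕ) → total M (λ ω → sum (λ i → g i ω)) ≡ sum (λ i → total M (g i))
total-sum zero    g = refl
total-sum (suc M) g = trans (sum-cong-≗ (λ c → total-sum M (λ i ω → g i (c ∷ ω))))
  (∑-comm (λ c i → total M (λ ω → g i (c ∷ ω))))

total-comm : ∀ M k (g : Vec (Fin A) M → Vec (Fin n) k → ℕ) →
  total M (λ ω → total k (g ω)) ≡ total k (λ t → total M (λ ω → g ω t))
total-comm M zero    g = refl
total-comm M (suc k) g = trans (total-sum M (λ i ω → total k (λ t → g ω (i ∷ t))))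
  (sum-cong-≗ (λ i → total-comm M k (λ ω t → g ω (i ∷ t))))

-- Redrawing one letter uniformly does not change the average.
resample : ∀ M (g : Vec (Fin A) M → ℕ) (x : Fin M) →
  A * total M g ≡ total M (λ ω → sum (λ c → g (ω [ x ]≔ c)))
resample {A} (suc M) g zero = begin
  A * sum (λ c → total M (λ ω → g (c ∷ ω)))              ≡⟨ sum-const A (sum (λ c → total M (λ ω → g (c ∷ ω)))) ⟨
  sum {A} (λ _ → sum (λ c → total M (λ ω → g (c ∷ ω))))  ≡⟨ sum-cong-≗ {A} (λ _ → sym (total-sum M (λ c ω → g (c ∷ ω)))) ⟩
  sum {A} (λ _ → total M (λ ω → sum (λ c → g (c ∷ ω))))  ∎
  where open ≡-Reasoning
resample {A} (suc M) g (suc x) = trans (*-distribˡ-sum A (λ c → total M (λ ω → g (c ∷ ω))))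
  (sum-cong-≗ (λ c → resample M (λ ω → g (c ∷ ω)) x))

below-average : (h : Fin a → ℕ) → sum h < a * b → ∃[ c ] h c < b
below-average {suc a} {b} h lt with h zero <? b
... | yes p = zero , p
... | no ¬p with below-average {a} {b} (h ∘ suc) (+-cancelˡ-< b _ _ (≤-<-trans (+-monoˡ-≤ (sum (h ∘ suc)) (≮⇒≥ ¬p)) lt))
...   | c , q = suc c , q

-- The method of conditional expectations: letters are fixed one at a time so that the average over
-- the remaining ones stays below 1.
vanishing-point : ∀ M (g : Vec (Fin A) M → ℕ) → total M g < A ^ M → ∃[ ω ] g ω ≡ 0
vanishing-point zero    g lt = [] , n<1⇒n≡0 lt
vanishing-point {A} (suc M) g lt with below-average {A} {A ^ M} _ lt
... | c , lt′ with vanishing-point M (λ ω → g (c ∷ ω)) lt′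
...   | ω , eq = c ∷ ω , eq

agreement : ∀ E → (x y : Fin E → Fin M) → Vec (Fin A) M → ℕ
agreement zero    x y ω = 1
agreement (suc E) x y ω = δ (lookup ω (x zero)) (lookup ω (y zero)) * agreement E (x ∘ suc) (y ∘ suc) ω

agreement-holds : ∀ E (x y : Fin E → Fin M) (ω : Vec (Fin A) M) →
  (∀ i → lookup ω (x i) ≡ lookup ω (y i)) → agreement E x y ω ≡ 1
agreement-holds zero    x y ω h = refl
agreement-holds (suc E) x y ω h rewrite h zero | δ-refl (lookup ω (y zero)) | agreement-holds E (x ∘ suc) (y ∘ suc) ω (h ∘ suc) = refl

agreement-update : ∀ E (x y : Fin E → Fin M) (ω : Vec (Fin A) M) z c →
  (∀ i → x i ≢ z) → (∀ i → y i ≢ z) → agreement E x y (ω [ z ]≔ c) ≡ agreement E x y ω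
agreement-update zero    x y ω z c hx hy = refl
agreement-update (suc E) x y ω z c hx hy = cong₂ _*_
  (cong₂ δ (Vec.lookup∘update′ (hx zero) ω c) (Vec.lookup∘update′ (hy zero) ω c))
  (agreement-update E (x ∘ suc) (y ∘ suc) ω z c (hx ∘ suc) (hy ∘ suc))

-- Each equality ω (x i) = ω (y i) has its own free letter ω (x i), so the equalities are independent.
agreement-total : ∀ E (x y : Fin E → Fin M) → Injective _≡_ _≡_ x → (∀ i j → x i ≢ y j) →
  A ^ E * total M (agreement {A = A} E x y) ≡ A ^ M
agreement-total {M} {A} zero x y inj apart =
  trans (*-identityˡ _) (trans (total-const M 1) (*-identityʳ (A ^ M)))
agreement-total {M} {A} (suc E) x y inj apart = begin
  A ^ suc E * total M g                      ≡⟨ trans (cong (_* total M g) (*-comm A (A ^ E))) (*-assoc (A ^ E) A (total M g)) ⟩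
  A ^ E * (A * total M g)                    ≡⟨ cong (A ^ E *_) (resample M g x₀) ⟩
  A ^ E * total M (λ ω → sum (λ c → g (ω [ x₀ ]≔ c))) ≡⟨ cong (A ^ E *_) (total-cong M free) ⟩
  A ^ E * total M rest                       ≡⟨ agreement-total E (x ∘ suc) (y ∘ suc) (suc-injective ∘ inj) (λ i j → apart (suc i) (suc j)) ⟩
  A ^ M                                      ∎
  where
  open ≡-Reasoning
  x₀ = x zero
  y₀ = y zero
  g rest : Vec (Fin A) M → ℕ
  g    = agreement (suc E) x y
  rest = agreement E (x ∘ suc) (y ∘ suc)
  free : ∀ ω → sum (λ c → g (ω [ x₀ ]≔ c)) ≡ rest ω
  free ω = begin
    sum (λ c → g (ω [ x₀ ]≔ c))                ≡⟨ sum-cong-≗ (λ c → cong₂ _*_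
        (trans (cong₂ δ (Vec.lookup∘update x₀ ω c) (Vec.lookup∘update′ (apart zero zero ∘ sym) ω c)) (δ-sym c (lookup ω y₀)))
        (agreement-update E (x ∘ suc) (y ∘ suc) ω x₀ c (λ i e → case inj e of λ ()) (λ i e → apart zero (suc i) (sym e)))) ⟩
    sum (λ c → δ (lookup ω y₀) c * rest ω)     ≡⟨ sum-δ (lookup ω y₀) (λ _ → rest ω) ⟩
    rest ω                                     ∎

module _ (close : Fin n → Fin n → Bool) where

  Far : Vec (Fin n) m → Set
  Far t = ∀ i j → i ≢ j → close (lookup t i) (lookup t j) ≡ false

  far? : (t : Vec (Fin n) m) → Dec (Far t)
  far? t = all? (λ i → all? (λ j → ¬? (i ≟ j) →-dec (close (lookup t i) (lookup t j) Bool.≟ false)))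

  -- Greedy selection: choosing a vertex of `P` and discarding everything close to it removes at
  -- most `B` vertices, so k + 1 choices are possible.
  far-tuple : ∀ B → (∀ v → count (close v) ≤ B) → (∀ v w → close v w ≡ close w v) →
    ∀ k (P : Fin n → Bool) → k * B < count P →
    Σ (Vec (Fin n) (suc k)) λ t → Far t × (∀ i → P (lookup t i) ≡ true)
  far-tuple B small close-sym zero P lt with sum-pos (χ ∘ P) lt
  ... | v , h = v ∷ [] , (λ { zero zero ne → contradiction refl ne }) , λ { zero → χ-pos h }
  far-tuple B small close-sym (suc k) P lt with sum-pos (χ ∘ P) (≤-trans (s≤s z≤n) lt)
  ... | v , h with far-tuple B small close-sym k (λ w → P w ∧ not (close v w))
                     (+-cancelˡ-< B _ _ (<-≤-trans lt enough))
    where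
    open ≤-Reasoning
    pointwise : ∀ w → χ (P w) ≤ χ (close v w) + χ (P w ∧ not (close v w))
    pointwise w with P w | close v w
    ... | false | _     = z≤n
    ... | true  | true  = s≤s z≤n
    ... | true  | false = ≤-refl
    enough : count P ≤ B + count (λ w → P w ∧ not (close v w))
    enough = begin
      count P                                                            ≤⟨ sum-mono pointwise ⟩
      sum (λ w → χ (close v w) + χ (P w ∧ not (close v w)))              ≡⟨ ∑-distrib-+ (χ ∘ close v) (λ w → χ (P w ∧ not (close v w))) ⟩
      count (close v) + count (λ w → P w ∧ not (close v w))              ≤⟨ +-monoˡ-≤ _ (small v) ⟩
      B + count (λ w → P w ∧ not (close v w))                            ∎
  ...   | t , far , all = v ∷ t , far′ , λ { zero → χ-pos h ; (suc i) → proj₁ (∧-true {P (lookup t i)} (all i)) }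
    where
    apart : ∀ i → close v (lookup t i) ≡ false
    apart i = Bool.not-injective {y = false} (proj₂ (∧-true {P (lookup t i)} (all i)))
    far′ : Far (v ∷ t)
    far′ zero    zero    ne = contradiction refl ne
    far′ zero    (suc j) ne = apart j
    far′ (suc i) zero    ne = trans (close-sym (lookup t i) v) (apart i)
    far′ (suc i) (suc j) ne = far i j (ne ∘ cong suc)

  module _ {A M S : ℕ} .{{_ : NonZero A}} (slot : Fin n → Fin S → Fin M)
    (slot-injective : ∀ v → Injective _≡_ _≡_ (slot v))
    (slot-close : ∀ {v w s s′} → slot v s ≡ slot w s′ → close v w ≡ true) where

    Monochromatic : Vec (Fin A) M → Vec (Fin n) (suc k) → Set
    Monochromatic ω t = ∀ i s → lookup ω (slot (lookup t (suc i)) s) ≡ lookup ω (slot (lookup t zero) s)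

    private
      module _ {k : ℕ} (t : Vec (Fin n) (suc k)) where
        -- The k S equations saying that the later vertices of `t` read the same letters as its
        -- first vertex. When `t` is far, the left sides `x` are distinct and do not occur among the
        -- right sides `y`, as `agreement-total` requires.
        x y : Fin (k * S) → Fin M
        x z = slot (lookup t (suc (proj₁ (remQuot {k} S z)))) (proj₂ (remQuot {k} S z))
        y z = slot (lookup t zero) (proj₂ (remQuot {k} S z))

        far-slots : Far t → ∀ {i j s s′} → slot (lookup t i) s ≡ slot (lookup t j) s′ → i ≡ j
        far-slots far {i} {j} e with i ≟ j
        ... | yes i≡j = i≡j
        ... | no  i≢j = case trans (sym (slot-close e)) (far i j i≢j) of λ ()

        x-injective : Far t → Injective _≡_ _≡_ x
        x-injective far {z} {z′} e = begin
          z                                  ≡⟨ combine-remQuot {k} S z ⟨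
          uncurry combine (remQuot {k} S z)  ≡⟨ cong₂ combine i≡i′ s≡s′ ⟩
          uncurry combine (remQuot {k} S z′) ≡⟨ combine-remQuot {k} S z′ ⟩
          z′                                 ∎
          where
          open ≡-Reasoning
          i≡i′ = suc-injective (far-slots far e)
          s≡s′ = slot-injective _ (trans e (cong (λ i → slot (lookup t (suc i)) (proj₂ (remQuot {k} S z′))) (sym i≡i′)))

      bad : ∀ k → Vec (Fin A) M → Vec (Fin n) (suc k) → ℕ
      bad k ω t = χ (does (far? t)) * agreement (k * S) (x t) (y t) ω

      bad-total : ∀ k (t : Vec (Fin n) (suc k)) → A ^ (k * S) * total M (λ ω → bad k ω t) ≤ A ^ M
      bad-total k t = guarded (far? t)
        where
        guarded : (D : Dec (Far t)) →
          A ^ (k * S) * total {A} M (λ ω → χ (does D) * agreement (k * S) (x t) (y t) ω) ≤ A ^ M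
        guarded (no _) = ≤-trans (≤-reflexive (trans
          (cong (A ^ (k * S) *_) (trans (total-const M 0) (*-zeroʳ (A ^ M)))) (*-zeroʳ (A ^ (k * S))))) z≤n
        guarded (yes far) = ≤-reflexive (trans
          (cong (A ^ (k * S) *_) (total-cong M (λ ω → +-identityʳ (agreement (k * S) (x t) (y t) ω))))
          (agreement-total (k * S) (x t) (y t) (x-injective t far) (λ i j e → case far-slots t far e of λ ())))

    -- A union bound: each of the n^(k + 1) tuples is bad for at most a fraction A^(-k S) of the
    -- letter choices, so some choice has no bad tuple.
    rainbow : ∀ k → n ^ suc k < A ^ (k * S) →
      Σ (Vec (Fin A) M) λ ω → (t : Vec (Fin n) (suc k)) → Far t → ¬ Monochromatic ω t
    rainbow k small with vanishing-point M (λ ω → total (suc k) (bad k ω)) few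
      where
      open ≤-Reasoning
      few : total M (λ ω → total (suc k) (bad k ω)) < A ^ M
      few = *-cancelˡ-< (A ^ (k * S)) _ _ (begin-strict
        A ^ (k * S) * total M (λ ω → total (suc k) (bad k ω))             ≡⟨ cong (A ^ (k * S) *_) (total-comm M (suc k) (bad k)) ⟩
        A ^ (k * S) * total (suc k) (λ t → total M (λ ω → bad k ω t))     ≡⟨ total-* (suc k) (A ^ (k * S)) (λ t → total M (λ ω → bad k ω t)) ⟩
        total (suc k) (λ t → A ^ (k * S) * total M (λ ω → bad k ω t))     ≤⟨ total-mono (suc k) (bad-total k) ⟩
        total {n} (suc k) (λ t → A ^ M)                                   ≡⟨ total-const {n} (suc k) (A ^ M) ⟩
        n ^ suc k * A ^ M                                                 <⟨ *-monoˡ-< (A ^ M) {{m^n≢0 A M}} small ⟩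
        A ^ (k * S) * A ^ M                                               ∎)
    ... | ω , eq = ω , λ t far mono → case trans (sym (good t far mono)) (n≤0⇒n≡0 (subst (bad k ω t ≤_) eq (term≤total (suc k) (bad k ω) t))) of λ ()
      where
      good : ∀ t → Far t → Monochromatic ω t → bad k ω t ≡ 1
      good t far mono = cong₂ (λ b c → χ b * c) (does-true (far? t) far)
        (agreement-holds (k * S) (x t) (y t) ω (λ z → mono (proj₁ (remQuot {k} S z)) (proj₂ (remQuot {k} S z))))

-- Ranks, and walks in graphs of bounded degree

rank : (Fin n → Bool) → Fin n → ℕ
rank P zero    = 0
rank P (suc v) = χ (P zero) + rank (P ∘ suc) v

rank<count : (P : Fin n → Bool) → ∀ v → P v ≡ true → rank P v < count P
rank<count P zero    h rewrite h = s≤s z≤n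
rank<count P (suc v) h = +-monoʳ-< (χ (P zero)) (rank<count (P ∘ suc) v h)

rank-injective : (P : Fin n → Bool) → ∀ v w → P v ≡ true → P w ≡ true → rank P v ≡ rank P w → v ≡ w
rank-injective P zero    zero    hv hw e = refl
rank-injective P zero    (suc w) hv hw e rewrite hv = case e of λ ()
rank-injective P (suc v) zero    hv hw e rewrite hw = case e of λ ()
rank-injective P (suc v) (suc w) hv hw e = cong suc (rank-injective (P ∘ suc) v w hv hw (+-cancelˡ-≡ (χ (P zero)) _ _ e))

private
  variable
    l p r s D : ℕ

module _ (H : Graph n) where

  -- Standing still is allowed, so that fixed points of a parent map give steps and walks can be
  -- lengthened at will: a walk of length r then means distance at most r.
  Step : Fin n → Fin n → Set
  Step v u = u ≡ v ⊎ adj H v u ≡ true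

  data Walk : ℕ → Fin n → Fin n → Set where
    []  : ∀ {v} → Walk 0 v v
    _∷_ : ∀ {r v u w} → Step v u → Walk r u w → Walk (suc r) v w

  step-sym : ∀ {v u} → Step v u → Step u v
  step-sym (inj₁ e) = inj₁ (sym e)
  step-sym {v} {u} (inj₂ h) = inj₂ (trans (Graph.sym H u v) h)

  walk-++ : ∀ {v u w} → Walk r v u → Walk s u w → Walk (r + s) v w
  walk-++ []      q = q
  walk-++ (e ∷ p) q = e ∷ walk-++ p q

  walk-∷ʳ : ∀ {v u w} → Walk r v u → Step u w → Walk (suc r) v w
  walk-∷ʳ []      e = e ∷ []
  walk-∷ʳ (f ∷ p) e = f ∷ walk-∷ʳ p e

  walk-sym : ∀ {v w} → Walk r v w → Walk r w v
  walk-sym []      = []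
  walk-sym (e ∷ p) = walk-∷ʳ (walk-sym p) (step-sym e)

  walk-stay : ∀ r v → Walk r v v
  walk-stay zero    v = []
  walk-stay (suc r) v = inj₁ refl ∷ walk-stay r v

  walk-lengthen : ∀ {v w} → r ≤ s → Walk r v w → Walk s v w
  walk-lengthen {r} {s} {v} r≤s p = subst (λ t → Walk t _ _) (m∸n+n≡m r≤s) (walk-++ (walk-stay (s ∸ r) v) p)

  walk-iterate : (π : Fin n → Fin n) → (∀ v → Step v (π v)) → ∀ v a → Walk a v (iterate π v a)
  walk-iterate π h v zero    = []
  walk-iterate π h v (suc a) = h v ∷ walk-iterate π h (π v) a

  lazy : Fin n → Fin n → ℕ
  lazy v u = δ v u + χ (adj H v u)

  -- Powers of the identity plus the adjacency matrix. Its row sums are at most D + 1, which bounds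
  -- balls of radius r by (D + 1)^r.
  walks : ℕ → Fin n → Fin n → ℕ
  walks zero    v w = δ v w
  walks (suc r) v w = sum (λ u → lazy v u * walks r u w)

  lazy-pos : ∀ {v u} → Step v u → 1 ≤ lazy v u
  lazy-pos {v} {u} (inj₁ refl) = ≤-trans (≤-reflexive (sym (δ-refl v))) (m≤m+n (δ v v) _)
  lazy-pos {v} {u} (inj₂ h)    = ≤-trans (≤-reflexive (cong χ (sym h))) (m≤n+m _ (δ v u))

  pos-lazy : ∀ {v u} → 1 ≤ lazy v u → Step v u
  pos-lazy {v} {u} h with v ≟ u | adj H v u
  ... | yes e | _    = inj₁ (sym e)
  ... | no  _ | true = inj₂ refl

  walks-pos : ∀ {v w} → Walk r v w → 1 ≤ walks r v w
  walks-pos {v = v} [] = ≤-reflexive (sym (δ-refl v))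
  walks-pos {suc r} {v} {w} (_∷_ {u = u} e p) =
    ≤-trans (*-mono-≤ (lazy-pos e) (walks-pos p)) (term≤sum (λ u → lazy v u * walks r u w) u)

  pos-walks : ∀ r {v w} → 1 ≤ walks r v w → Walk r v w
  pos-walks zero    {v} {w} h with true-does (v ≟ w) (χ-pos h)
  ... | refl = []
  pos-walks (suc r) {v} {w} h with sum-pos (λ u → lazy v u * walks r u w) h
  ... | u , hu = pos-lazy (factorˡ (lazy v u) (walks r u w) hu) ∷ pos-walks r (factorʳ (lazy v u) (walks r u w) hu)
    where
    factorˡ : ∀ x y → 1 ≤ x * y → 1 ≤ x
    factorˡ (suc x) y _ = s≤s z≤n
    factorʳ : ∀ x y → 1 ≤ x * y → 1 ≤ y
    factorʳ x zero    h rewrite *-zeroʳ x = h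
    factorʳ x (suc y) _ = s≤s z≤n

  module _ (D : ℕ) (deg≤D : ∀ v → deg H v ≤ D) where

    lazy-row : ∀ v → sum (lazy v) ≤ suc D
    lazy-row v = begin
      sum (lazy v)                            ≡⟨ ∑-distrib-+ (δ v) (χ ∘ adj H v) ⟩
      sum (δ v) + count (adj H v)             ≡⟨ cong₂ _+_ (sum-δ₁ v) (sym (deg-sum H v)) ⟩
      1 + deg H v                             ≤⟨ s≤s (deg≤D v) ⟩
      suc D                                   ∎
      where open ≤-Reasoning

    walks-row : ∀ r v → sum (walks r v) ≤ suc D ^ r
    walks-row zero    v = ≤-reflexive (sum-δ₁ v)
    walks-row (suc r) v = begin
      sum (λ w → sum (λ u → lazy v u * walks r u w))  ≡⟨ ∑-comm (λ w u → lazy v u * walks r u w) ⟩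
      sum (λ u → sum (λ w → lazy v u * walks r u w))  ≡⟨ sum-cong-≗ (λ u → *-distribˡ-sum (lazy v u) (walks r u)) ⟨
      sum (λ u → lazy v u * sum (walks r u))          ≤⟨ sum-mono (λ u → *-monoʳ-≤ (lazy v u) (walks-row r u)) ⟩
      sum (λ u → lazy v u * suc D ^ r)                ≡⟨ *-distribʳ-sum (suc D ^ r) (lazy v) ⟨
      sum (lazy v) * suc D ^ r                        ≤⟨ *-monoˡ-≤ (suc D ^ r) (lazy-row v) ⟩
      suc D ^ suc r                                   ∎
      where open ≤-Reasoning

  close : ℕ → Fin n → Fin n → Bool
  close r v w = does (1 ≤? walks r v w)

  walk-close : ∀ {v w} → Walk r v w → close r v w ≡ true
  walk-close {r} {v} {w} p = does-true (1 ≤? walks r v w) (walks-pos p)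

  close-sym : ∀ r v w → close r v w ≡ close r w v
  close-sym r v w = Bool-≡ (flip v w) (flip w v)
    where
    flip : ∀ v w → close r v w ≡ true → close r w v ≡ true
    flip v w h = walk-close (walk-sym (pos-walks r (true-does (1 ≤? walks r v w) h)))

  count-close : (∀ v → deg H v ≤ D) → ∀ r v → count (close r v) ≤ suc D ^ r
  count-close {D} deg≤D r v = ≤-trans (sum-mono bound) (walks-row D deg≤D r v)
    where
    bound : ∀ w → χ (close r v w) ≤ walks r v w
    bound w with walks r v w
    ... | zero  = z≤n
    ... | suc _ = s≤s z≤n

-- Labelling the vertices with linked words

Shifted : Vec (Fin A) (suc k) → Vec (Fin A) (suc k) → Set
Shifted {A} {k} w w′ = Σ (Fin A) λ x → Σ (Vec (Fin A) k) λ u → Σ (Fin A) λ y → w ≡ x ∷ u × w′ ≡ u ∷ʳ y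

Linked : Vec (Fin A) (suc k) → Vec (Fin A) (suc k) → Set
Linked w w′ = w ≡ w′ ⊎ Shifted w w′ ⊎ Shifted w′ w

iterate-∷ʳ : {X : Set} (f : X → X) (x : X) (k : ℕ) → Vec.iterate f x (suc k) ≡ Vec.iterate f x k ∷ʳ iterate f x k
iterate-∷ʳ f x zero    = refl
iterate-∷ʳ f x (suc k) = cong (x ∷_) (iterate-∷ʳ f (f x) k)

iterate-shifted : {X : Set} (f : X → X) (g : X → Fin A) (x : X) (k : ℕ) →
  Shifted (Vec.map g (Vec.iterate f x (suc k))) (Vec.map g (Vec.iterate f (f x) (suc k)))
iterate-shifted f g x k = g x , Vec.map g (Vec.iterate f (f x) k) , g (iterate f (f x) k) , refl ,
  trans (cong (Vec.map g) (iterate-∷ʳ f (f x) k)) (Vec.map-∷ʳ g (iterate f (f x) k) (Vec.iterate f (f x) k))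

Words : ℕ → ℕ → ℕ → Set
Words A k p = Vec (Vec (Fin A) k) p

_≟ʷ_ : ∀ {p} (w w′ : Words A k p) → Dec (w ≡ w′)
_≟ʷ_ = Vec.≡-dec (Vec.≡-dec _≟_)

module _ (H : Graph n) (deg≤D : ∀ v → deg H v ≤ D) {p : ℕ} (π : Fin p → Fin n → Fin n)
         (parent : ∀ c v → Step H v (π c v)) (l : ℕ) where

  private
    L R : ℕ
    L = suc l
    -- A vertex reads letters at distance at most 2L: L for the reading time and L for the jump to a
    -- representative. Two vertices with a common letter are therefore within 4L.
    R = (L + L) + (L + L)

    module W (c : Fin p) = Walks (π c) l

    -- Every colour has its own letters, one for each vertex and counter value. The counters that
    -- are read stay below `L`, so reduction modulo `L` identifies no two of them.
    variable-of : Fin p → Fin n × ℕ → Fin (p * (n * L))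
    variable-of c (u , i) = combine c (combine u (i mod L))

    slotAt : Fin n → Fin p → Fin L → Fin (p * (n * L))
    slotAt v c j = variable-of c (W.state c v (toℕ j))

    slot : Fin n → Fin (p * L) → Fin (p * (n * L))
    slot v s = slotAt v (proj₁ (remQuot {p} L s)) (proj₂ (remQuot {p} L s))

    mod-injective : ∀ {i i′} → i < L → i′ < L → i mod L ≡ i′ mod L → i ≡ i′
    mod-injective {i} {i′} i<L i′<L e = begin
      i              ≡⟨ m<n⇒m%n≡m i<L ⟨
      i % L          ≡⟨ toℕ-fromℕ< (m%n<n i L) ⟨
      toℕ (i mod L)  ≡⟨ cong toℕ e ⟩
      toℕ (i′ mod L) ≡⟨ toℕ-fromℕ< (m%n<n i′ L) ⟩
      i′ % L         ≡⟨ m<n⇒m%n≡m i′<L ⟩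
      i′             ∎
      where open ≡-Reasoning

    slotAt-injective : ∀ {v w c c′ j j′} → slotAt v c j ≡ slotAt w c′ j′ →
      c ≡ c′ × W.state c v (toℕ j) ≡ W.state c′ w (toℕ j′)
    slotAt-injective {v} {w} {c} {c′} {j} {j′} e =
      let c≡ , e′ = combine-injective c _ c′ _ e
          u≡ , i≡ = combine-injective (proj₁ (W.state c v (toℕ j))) _ (proj₁ (W.state c′ w (toℕ j′))) _ e′
      in c≡ , cong₂ _,_ u≡ (mod-injective (≤-<-trans (proj₁ (W.state-position c v (toℕ j))) (toℕ<n j))
                                          (≤-<-trans (proj₁ (W.state-position c′ w (toℕ j′))) (toℕ<n j′)) i≡)

    slot-injective : ∀ v → Injective _≡_ _≡_ (slot v)
    slot-injective v {s} {s′} e = trans (sym (combine-remQuot {p} L s)) (trans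
      (go (remQuot {p} L s) (remQuot {p} L s′) e) (combine-remQuot {p} L s′))
      where
      go : (cj cj′ : Fin p × Fin L) → uncurry (slotAt v) cj ≡ uncurry (slotAt v) cj′ → uncurry combine cj ≡ uncurry combine cj′
      go (c , j) (c′ , j′) e with slotAt-injective {v} {v} {c} {c′} {j} {j′} e
      ... | refl , same = cong (combine c) (toℕ-injective (W.state-injective c v (toℕ<n j) (toℕ<n j′) same))

    slotAt-close : ∀ {v w c c′ j j′} → slotAt v c j ≡ slotAt w c′ j′ → close H R v w ≡ true
    slotAt-close {v} {w} {c} {c′} {j} {j′} e with slotAt-injective {v} {w} {c} {c′} {j} {j′} e
    ... | refl , same =
      let a , a≤ , v↝ = W.state-reachable c v (toℕ<n j)
          b , b≤ , w↝ = W.state-reachable c w (toℕ<n j′)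
          walk-from : ∀ v {x a} → a ≤ L + L → x ≡ iterate (π c) v a → Walk H (L + L) v x
          walk-from v {a = a} a≤ e = subst (Walk H (L + L) v) (sym e) (walk-lengthen H a≤ (walk-iterate H (π c) (parent c) v a))
      in walk-close H (walk-++ H (walk-from v a≤ (trans (sym (cong proj₁ same)) v↝)) (walk-sym H (walk-from w b≤ w↝)))

    slot-close : ∀ {v w s s′} → slot v s ≡ slot w s′ → close H R v w ≡ true
    slot-close {v} {w} {s} {s′} = slotAt-close {v} {w} {proj₁ (remQuot {p} L s)} {proj₁ (remQuot {p} L s′)}
                                               {proj₂ (remQuot {p} L s)} {proj₂ (remQuot {p} L s′)}

    module _ {A : ℕ} (ω : Vec (Fin A) (p * (n * L))) where

      word : Fin n → Fin p → Vec (Fin A) L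
      word v c = Vec.map (λ s → lookup ω (variable-of c s)) (Vec.iterate (W.move c) (W.start c v) L)

      words : Fin n → Words A L p
      words v = Vec.tabulate (word v)

      word-linked : ∀ c v → Linked (word v c) (word (π c v) c)
      word-linked c v with W.start-parent c v
      ... | inj₁ e = inj₁ (cong (λ s → Vec.map (λ s → lookup ω (variable-of c s)) (Vec.iterate (W.move c) s L)) (sym e))
      ... | inj₂ e = inj₂ (inj₁ (subst (λ s → Shifted (word v c) (Vec.map (λ s → lookup ω (variable-of c s)) (Vec.iterate (W.move c) s L)))
        (sym e) (iterate-shifted (W.move c) (λ s → lookup ω (variable-of c s)) (W.start c v) l)))

      words-letter : ∀ v c j → lookup (lookup (words v) c) j ≡ lookup ω (slotAt v c j)
      words-letter v c j = begin
        lookup (lookup (words v) c) j                             ≡⟨ cong (λ x → lookup x j) (Vec.lookup∘tabulate (word v) c) ⟩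
        lookup (word v c) j                                       ≡⟨ Vec.lookup-map j _ (Vec.iterate (W.move c) (W.start c v) L) ⟩
        lookup ω (variable-of c (lookup (Vec.iterate (W.move c) (W.start c v) L) j))
                                                                  ≡⟨ cong (λ s → lookup ω (variable-of c s)) (Vec.lookup-iterate (W.move c) (W.start c v) j) ⟩
        lookup ω (slotAt v c j)                                   ∎
        where open ≡-Reasoning

  -- A larger fibre would contain k + 1 pairwise far vertices by `far-tuple`; having the same words
  -- they would be monochromatic, which `rainbow` excludes.
  labelling : ∀ {A} .{{_ : NonZero A}} k → n ^ suc k < A ^ (k * (p * L)) →
    Σ (Fin n → Words A L p) λ f → (∀ c v → Linked (lookup (f v) c) (lookup (f (π c v)) c)) ×
      (∀ z → count (λ w → does (f w ≟ʷ z)) ≤ k * suc D ^ R)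
  labelling {A} k small with rainbow (close H R) {A} slot slot-injective slot-close k small
  ... | ω , none = words ω
      , (λ c v → subst₂ Linked (sym (Vec.lookup∘tabulate (word ω v) c)) (sym (Vec.lookup∘tabulate (word ω (π c v)) c)) (word-linked ω c v))
      , λ z → ≮⇒≥ (λ big → collision z (far-tuple (close H R) (suc D ^ R)
          (count-close H deg≤D R) (close-sym H R) k (λ w → does (words ω w ≟ʷ z)) big))
    where
    collision : ∀ z → Σ (Vec (Fin n) (suc k)) (λ t → Far (close H R) t × (∀ i → does (words ω (lookup t i) ≟ʷ z) ≡ true)) → _
    collision z (t , far , all) = none t far λ i s →
      let c = proj₁ (remQuot {p} L s)
          j = proj₂ (remQuot {p} L s)
          same = trans (true-does (words ω (lookup t (suc i)) ≟ʷ z) (all (suc i))) (sym (true-does (words ω (lookup t zero) ≟ʷ z) (all zero)))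
      in trans (sym (words-letter ω (lookup t (suc i)) c j)) (trans (cong (λ x → lookup (lookup x c) j) same) (words-letter ω (lookup t zero) c j))

private
  variable
    N Δ : ℕ
    S T : Set

-- The universal graph

record Coding (T : Set) (N : ℕ) : Set where
  field
    encode : T → Fin N
    decode : Fin N → T
    decode-encode : ∀ t → decode (encode t) ≡ t

open Coding

Fin-coding : Coding (Fin N) N
Fin-coding = record { encode = id ; decode = id ; decode-encode = λ _ → refl }

×-coding : Coding S M → Coding T N → Coding (S × T) (M * N)
×-coding {M = M} {N = N} c d = record
  { encode = λ (s , t) → combine (encode c s) (encode d t)
  ; decode = λ x → decode c (proj₁ (remQuot {M} N x)) , decode d (proj₂ (remQuot {M} N x))
  ; decode-encode = λ (s , t) → cong₂ _,_
      (trans (cong (decode c ∘ proj₁) (remQuot-combine (encode c s) (encode d t))) (decode-encode c s))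
      (trans (cong (decode d ∘ proj₂) (remQuot-combine (encode c s) (encode d t))) (decode-encode d t)) }

Vec-coding : Coding T N → ∀ k → Coding (Vec T k) (N ^ k)
Vec-coding c zero = record { encode = λ _ → zero ; decode = λ _ → [] ; decode-encode = λ { [] → refl } }
Vec-coding c (suc k) = record
  { encode = λ { (t ∷ ts) → encode d (t , ts) }
  ; decode = λ x → proj₁ (decode d x) ∷ proj₂ (decode d x)
  ; decode-encode = λ { (t ∷ ts) → cong (λ (t , ts) → t ∷ ts) (decode-encode d (t , ts)) } }
  where d = ×-coding c (Vec-coding c k)

encode-injective : (c : Coding T N) → Injective _≡_ _≡_ (encode c)
encode-injective c {s} {t} e = trans (sym (decode-encode c s)) (trans (cong (decode c) e) (decode-encode c t))

module _ (next : Fin N → Fin Δ → Fin N) where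

  reaches : Fin N → Fin N → Bool
  reaches x y = anyᵇ (λ c → does (next x c ≟ y))

  -- Neighbours are presented as results of labelled moves, so that edges are bounded by counting
  -- labels, however many labels give the same neighbour.
  moveGraph : Graph N
  moveGraph = record
    { adj    = λ x y → not (does (x ≟ y)) ∧ (reaches x y ∨ reaches y x)
    ; sym    = λ x y → cong₂ _∧_ (cong not (≟-sym x y)) (Bool.∨-comm (reaches x y) (reaches y x))
    ; irrefl = λ x → cong (λ b → not b ∧ (reaches x x ∨ reaches x x)) (does-true (x ≟ x) refl) }
    where
    ≟-sym : ∀ {n} (x y : Fin n) → does (x ≟ y) ≡ does (y ≟ x)
    ≟-sym zero    zero    = refl
    ≟-sym zero    (suc y) = refl
    ≟-sym (suc x) zero    = refl
    ≟-sym (suc x) (suc y) = ≟-sym x y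

  moveGraph-adj : ∀ {x y} c → next x c ≡ y → x ≢ y → adj moveGraph x y ≡ true
  moveGraph-adj {x} {y} c e x≢y = cong₂ _∧_ (apart (x ≟ y))
    (cong (_∨ reaches y x) (anyᵇ-intro (λ c → does (next x c ≟ y)) c (does-true (next x c ≟ y) e)))
    where
    apart : (d : Dec (x ≡ y)) → not (does d) ≡ true
    apart (yes x≡y) = contradiction x≡y x≢y
    apart (no _)    = refl

  moveGraph-edges : edges moveGraph ≤ 2 * (N * Δ)
  moveGraph-edges = begin
    edges moveGraph                                                     ≡⟨ edges-sum moveGraph ⟩
    sum (λ x → sum (λ y → χ (edge moveGraph x y)))                      ≤⟨ sum-mono (λ x → sum-mono (λ y →
                                                                             pointwise (x before y) (not (does (x ≟ y))) (reaches x y) (reaches y x))) ⟩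
    sum (λ x → sum (λ y → χ (reaches x y) + χ (reaches y x)))           ≡⟨ sum-cong-≗ (λ x → ∑-distrib-+ (λ y → χ (reaches x y)) (λ y → χ (reaches y x))) ⟩
    sum (λ x → count (reaches x) + sum (λ y → χ (reaches y x)))         ≡⟨ ∑-distrib-+ (λ x → count (reaches x)) (λ x → sum (λ y → χ (reaches y x))) ⟩
    out + sum (λ x → sum (λ y → χ (reaches y x)))                       ≡⟨ cong (out +_) (trans (∑-comm (λ x y → χ (reaches y x))) (sym (+-identityʳ out))) ⟩
    2 * out                                                             ≤⟨ *-monoʳ-≤ 2 (≤-trans (sum-mono row) (≤-reflexive (sum-const N Δ))) ⟩
    2 * (N * Δ)                                                         ∎
    where
    open ≤-Reasoning
    out = sum (λ x → count (reaches x))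
    pointwise : ∀ b c d e → χ (b ∧ (c ∧ (d ∨ e))) ≤ χ d + χ e
    pointwise false _     _     _     = z≤n
    pointwise true  false _     _     = z≤n
    pointwise true  true  true  _     = s≤s z≤n
    pointwise true  true  false true  = ≤-refl
    pointwise true  true  false false = z≤n
    row : ∀ x → count (reaches x) ≤ Δ
    row x = begin
      count (reaches x)                          ≤⟨ sum-mono hit ⟩
      sum (λ y → sum (λ c → δ (next x c) y))     ≡⟨ ∑-comm (λ y c → δ (next x c) y) ⟩
      sum (λ c → sum (δ (next x c)))             ≡⟨ sum-cong-≗ (λ c → sum-δ₁ (next x c)) ⟩
      sum {Δ} (λ c → 1)                          ≡⟨ sum-const Δ 1 ⟩
      Δ * 1                                      ≡⟨ *-identityʳ Δ ⟩
      Δ                                          ∎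
      where
      single : ∀ {s} b → (b ≡ true → 1 ≤ s) → χ b ≤ s
      single true  h = h refl
      single false h = z≤n
      hit : ∀ y → χ (reaches x y) ≤ sum (λ c → δ (next x c) y)
      hit y = single (reaches x y) λ h →
        let c , e = anyᵇ-elim (λ c → does (next x c ≟ y)) h
        in ≤-trans (≤-reflexive (cong χ (sym e))) (term≤sum (λ c → δ (next x c) y) c)

shift : Fin 3 → Fin A → Vec (Fin A) (suc l) → Vec (Fin A) (suc l)
shift zero             a w = w
shift (suc zero)       a w = Vec.tail w ∷ʳ a
shift (suc (suc zero)) a w = a ∷ Vec.init w

linked-shift : (a : Fin A) {w w′ : Vec (Fin A) (suc l)} → Linked w w′ → ∃[ i ] ∃[ b ] shift i b w ≡ w′
linked-shift a (inj₁ e) = zero , a , e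
linked-shift a (inj₂ (inj₁ (x , u , y , refl , refl))) = suc zero , y , refl
linked-shift a (inj₂ (inj₂ (x , u , y , refl , refl))) = suc (suc zero) , x , cong (x ∷_) (Vec.init-∷ʳ y u)

-- A coordinate with tag zero is overwritten by the next word of the supply (if there is one left).
rewriteWords : Words A (suc l) p → Vec (Fin 4 × Fin A) p → Vec (Vec (Fin A) (suc l)) r → Words A (suc l) p
rewriteWords []       []                 ws       = []
rewriteWords (x ∷ xs) ((zero  , a) ∷ ms) []       = x ∷ rewriteWords xs ms []
rewriteWords (x ∷ xs) ((zero  , a) ∷ ms) (w ∷ ws) = w ∷ rewriteWords xs ms ws
rewriteWords (x ∷ xs) ((suc i , a) ∷ ms) ws       = shift i a x ∷ rewriteWords xs ms ws

count≤ : (P : Fin p → Bool) → count P ≤ p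
count≤ {p} P = ≤-trans (sum-mono (λ i → χ≤1 (P i))) (≤-reflexive (trans (sum-const p 1) (*-identityʳ p)))

rewriteWords-reaches : (a : Fin A) (xs ys : Words A (suc l) p) (P : Fin p → Bool) →
  (∀ c → P c ≡ true → Linked (lookup xs c) (lookup ys c)) → ∀ r → p ≤ r + count P →
  Σ (Vec (Fin 4 × Fin A) p) λ ms → Σ (Vec (Vec (Fin A) (suc l)) r) λ ws → rewriteWords xs ms ws ≡ ys
rewriteWords-reaches a []       []       P linked r h = [] , Vec.replicate r (Vec.replicate _ a) , refl
rewriteWords-reaches {p = suc p} a (x ∷ xs) (y ∷ ys) P linked r h with P zero in eq
... | true =
  let i , b , e    = linked-shift a (linked zero eq)
      ms , ws , es = rewriteWords-reaches a xs ys (P ∘ suc) (linked ∘ suc) r (≤-pred (≤-trans h (≤-reflexive (+-suc r (count (P ∘ suc))))))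
  in (suc i , b) ∷ ms , ws , cong₂ _∷_ e es
rewriteWords-reaches {p = suc p} a (x ∷ xs) (y ∷ ys) P linked zero    h | false =
  contradiction (≤-trans h (count≤ (P ∘ suc))) (<⇒≱ (n<1+n p))
rewriteWords-reaches {p = suc p} a (x ∷ xs) (y ∷ ys) P linked (suc r) h | false =
  let ms , ws , es = rewriteWords-reaches a xs ys (P ∘ suc) (linked ∘ suc) r (≤-pred h)
  in (zero , a) ∷ ms , y ∷ ws , cong (y ∷_) es

linked-sym : {w w′ : Vec (Fin A) (suc l)} → Linked w w′ → Linked w′ w
linked-sym (inj₁ e)        = inj₁ (sym e)
linked-sym (inj₂ (inj₁ s)) = inj₂ (inj₂ s)
linked-sym (inj₂ (inj₂ s)) = inj₂ (inj₁ s)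

module WordGraph (A l p r K : ℕ) where

  -- `Fin K` numbers the copies in the blow-up. A move has four tags, one for overwriting and three
  -- for the cases of `Linked`; only its `r` fresh words contribute a power of n, all else is
  -- 2^O(s).
  Vertex Move : Set
  Vertex = Words A (suc l) p × Fin K
  Move   = (Vec (Fin 4 × Fin A) p × Vec (Vec (Fin A) (suc l)) r) × Fin K

  order moveCount : ℕ
  order = (A ^ suc l) ^ p * K
  moveCount = ((4 * A) ^ p * (A ^ suc l) ^ r) * K

  vertices : Coding Vertex order
  vertices = ×-coding (Vec-coding (Vec-coding Fin-coding (suc l)) p) Fin-coding

  moves : Coding Move moveCount
  moves = ×-coding (×-coding (Vec-coding (×-coding Fin-coding Fin-coding) p) (Vec-coding (Vec-coding Fin-coding (suc l)) r)) Fin-coding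

  act : Vertex → Move → Vertex
  act (xs , _) ((ms , ws) , i) = rewriteWords xs ms ws , i

  next : Fin order → Fin moveCount → Fin order
  next x c = encode vertices (act (decode vertices x) (decode moves c))

  next-encode : ∀ v c → next (encode vertices v) (encode moves c) ≡ encode vertices (act v c)
  next-encode v c = cong₂ (λ v c → encode vertices (act v c)) (decode-encode vertices v) (decode-encode moves c)

  wordGraph : Graph order
  wordGraph = moveGraph next

module _ (H : Graph n) (f : Fin n → Words A (suc l) p) {K : ℕ}
         (fibre : ∀ z → count (λ w → does (f w ≟ʷ z)) ≤ K) where

  private
    -- The copy of the tuple `f v` that `v` occupies is its rank within the fibre.
    index : Fin n → Fin K
    index v = fromℕ< (<-≤-trans (rank<count (λ w → does (f w ≟ʷ f v)) v (does-true (f v ≟ʷ f v) refl)) (fibre (f v)))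

    index-injective : ∀ {v w} → f v ≡ f w → index v ≡ index w → v ≡ w
    index-injective {v} {w} fv≡fw e = rank-injective (λ u → does (f u ≟ʷ f v)) v w
      (does-true (f v ≟ʷ f v) refl) (does-true (f w ≟ʷ f v) (sym fv≡fw)) (begin
        rank (λ u → does (f u ≟ʷ f v)) v  ≡⟨ toℕ-fromℕ< _ ⟨
        toℕ (index v)                     ≡⟨ cong toℕ e ⟩
        toℕ (index w)                     ≡⟨ toℕ-fromℕ< _ ⟩
        rank (λ u → does (f u ≟ʷ f w)) w  ≡⟨ cong (λ z → rank (λ u → does (f u ≟ʷ z)) w) fv≡fw ⟨
        rank (λ u → does (f u ≟ʷ f v)) w  ∎)
      where open ≡-Reasoning

  wordGraph-embedding : ∀ r → Fin A → (P : Fin n → Fin n → Fin p → Bool) →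
    (∀ u v c → P u v c ≡ true → Linked (lookup (f u) c) (lookup (f v) c)) →
    (∀ u v → adj H u v ≡ true → p ≤ r + count (P u v)) → H ⊆G WordGraph.wordGraph A l p r K
  wordGraph-embedding r a P linked enough = φ , φ-injective , preserves
    where
    open WordGraph A l p r K
    φ : Fin n → Fin order
    φ v = encode vertices (f v , index v)
    φ-injective : Injective _≡_ _≡_ φ
    φ-injective {v} {w} e =
      let same = encode-injective vertices {f v , index v} {f w , index w} e
      in index-injective (cong proj₁ same) (cong proj₂ same)
    preserves : ∀ u v → adj H u v ≡ true → adj wordGraph (φ u) (φ v) ≡ true
    preserves u v uv =
      let ms , ws , e = rewriteWords-reaches a (f u) (f v) (P u v) (linked u v) r (enough u v uv)
      in moveGraph-adj next (encode moves ((ms , ws) , index v))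
           (trans (next-encode (f u , index u) ((ms , ws) , index v)) (cong (λ x → encode vertices (x , index v)) e))
           (λ φu≡φv → case trans (sym uv) (trans (cong (adj H u) (sym (φ-injective φu≡φv))) (irrefl H u)) of λ ())

fibreBound : ℕ → ℕ → ℕ → ℕ
fibreBound D l k = k * suc D ^ ((suc l + suc l) + (suc l + suc l))

wordGraph-universal : (d : ℚ) → 1ℚ ℚ.< d → ∀ D n l A .{{_ : NonZero A}} k →
  n ^ suc k < A ^ (k * (num d * suc l)) → Fin A →
  Universal d D n (WordGraph.wordGraph A l (num d) (num d ∸ den d) (fibreBound D l k))
wordGraph-universal d 1<d D n l A k small a H (dense , deg≤D) =
  let π , parent , covered = pseudoforests d 1<d H dense
      f , linked , fibre   = labelling H deg≤D π parent l k small
      P u v c = does (π c u ≟ v) ∨ does (π c v ≟ u)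
      P-linked : ∀ u v c → P u v c ≡ true → Linked (lookup (f u) c) (lookup (f v) c)
      P-linked u v c h =
        [ (λ e → subst (λ x → Linked (lookup (f u) c) (lookup (f x) c)) (true-does (π c u ≟ v) e) (linked c u))
        , (λ e → linked-sym (subst (λ x → Linked (lookup (f v) c) (lookup (f x) c)) (true-does (π c v ≟ u) e) (linked c v))) ]′
        (∨-true {does (π c u ≟ v)} h)
  in wordGraph-embedding H f fibre (num d ∸ den d) a P P-linked
       (λ u v uv → ≤-trans (≤-reflexive (sym (m∸n+n≡m (<⇒≤ (den<num d 1<d))))) (+-monoʳ-≤ (num d ∸ den d) (covered u v uv)))

-- Small n, and the final estimate

emptyGraph : ∀ n → Graph n
emptyGraph n = record { adj = λ _ _ → false ; sym = λ _ _ → refl ; irrefl = λ _ → refl }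

⊆-emptyGraph : n < 2 → (H : Graph n) → H ⊆G emptyGraph n
⊆-emptyGraph {n} n<2 H = id , id , λ i j ij → contradiction (trans (sym ij) (no-edge n<2 H i j)) λ ()
  where
  no-edge : ∀ {n} → n < 2 → (H : Graph n) → ∀ i j → adj H i j ≡ false
  no-edge {suc zero}    _                H zero zero = irrefl H zero
  no-edge {suc (suc n)} (s≤s (s≤s ())) H

edges-emptyGraph : ∀ n → edges (emptyGraph n) ≡ 0
edges-emptyGraph n = trans (edges-sum (emptyGraph n))
  (sum-zero {n} (λ i → sum-zero {n} (λ j → cong χ (Bool.∧-zeroʳ (i before j)))))

suc[/]*≤ : ∀ s p .{{_ : NonZero p}} → suc (s / p) * p ≤ s + p
suc[/]*≤ s p = ≤-trans (+-monoʳ-≤ p (m/n*n≤m s p)) (≤-reflexive (+-comm p s))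

2*∸ : ∀ {p q} → q ≤ p → 2 * p ∸ q ≡ p + (p ∸ q)
2*∸ {p} {q} q≤p = trans (cong (λ x → p + x ∸ q) (+-identityʳ p)) (+-∸-assoc p q≤p)

large-graph : ∀ D (d : ℚ) → 1ℚ ℚ.< d → ∀ n l → n ≤ 2 ^ (suc l * suc l) → 2 ^ (l * l) ≤ n →
  ∃[ N ] Σ (Graph N) λ G → Universal d D n G ×
    (∀ s → suc l ≤ s → edges G ^ num d ≤ n ^ (num d + (num d ∸ den d)) * 2 ^ (num d * constant D (num d) * s))
large-graph D d 1<d n l n≤ ≤n = order , wordGraph
  -- The value `suc (suc l)` = s + 1 of `k` means tuples of s + 2 vertices.
  , wordGraph-universal d 1<d D n l (2 ^ exponent) {{m^n≢0 2 exponent}} (suc (suc l))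
      (enough-words n exponent (num d) l n≤ (<suc[/]* (suc l) (num d))) (fromℕ< (m^n>0 2 exponent))
  , edge-bound D n exponent l (num d) (num d ∸ den d) (suc[/]*≤ (suc l) (num d)) (m∸n≤m (num d) (den d)) ≤n
      (≤-trans (moveGraph-edges next)
        (edge-power exponent (suc l) (num d) (num d ∸ den d) _ (fibreBound D l (suc (suc l))) (fibre-exponent D l)))
  where
  instance
    num≢0 : NonZero (num d)
    num≢0 = >-nonZero (≤-<-trans z≤n (den<num d 1<d))
  exponent : ℕ
  -- This a satisfies s < a p ≤ s + p: the lower bound leaves the slack 2^s for the first-moment
  -- count, and the upper bound keeps the number of tuples within a factor 2^O(s) of n.
  exponent = suc (suc l / num d)
  open WordGraph (2 ^ exponent) l (num d) (num d ∸ den d) (fibreBound D l (suc (suc l)))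

-- The p-th power clears the denominator of 2 - q/p, and letting s range over all integers with s²
-- at least log n replaces the square root.
theorem1p4 : (D : ℕ) (d : ℚ) → 1ℚ ℚ.< d →
    ∃[ C ] ((n : ℕ) → ∃[ N ] Σ (Graph N) λ G →
    Universal d D n G ×
    ((s : ℕ) → n ≤ 2 ^ (s * s) →
    edges G ^ num d ≤ n ^ (2 * num d ∸ den d) * 2 ^ (num d * C * s)))
theorem1p4 D d 1<d = constant D (num d) , graph
  where
  graph : (n : ℕ) → ∃[ N ] Σ (Graph N) λ G → Universal d D n G ×
    ((s : ℕ) → n ≤ 2 ^ (s * s) →
      edges G ^ num d ≤ n ^ (2 * num d ∸ den d) * 2 ^ (num d * constant D (num d) * s))
  graph n with n <? 2
  -- Here the least `s` would be 0 and words would be empty. For n = 0 the right side vanishes, so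
  -- the graph has to be edgeless.
  ... | yes n<2 = n , emptyGraph n , (λ H _ → ⊆-emptyGraph n<2 H) , λ s _ →
    0^m≤ (num d) (edges-emptyGraph n) (≤-<-trans z≤n (den<num d 1<d))
    where
    0^m≤ : ∀ {e x} m → e ≡ 0 → 0 < m → e ^ m ≤ x
    0^m≤ (suc m) refl _ = z≤n
  -- The words get the least admissible length; any other `s` in the claim is at least as large, and
  -- the right side grows with `s`.
  ... | no n≮2 with least n (λ s → n ≤? 2 ^ (s * s)) (n≤2^n² n)
    where
    n≤2^n² : ∀ n → n ≤ 2 ^ (n * n)
    n≤2^n² zero      = z≤n
    n≤2^n² n@(suc _) = ≤-trans (<⇒≤ (n<2^n n)) (^-monoʳ-≤ 2 (m≤m*n n n))
  ...   | zero , n≤1 , _ = contradiction (s≤s n≤1) n≮2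
  ...   | suc l , n≤ , minimal =
    -- Minimality rules out `l` = s - 1, whence 2^(l²) ≤ n; this is what converts powers of 2 into
    -- powers of n.
    let N , G , universal , bound = large-graph D d 1<d n l n≤ (≰⇒≥ (λ n≤′ → <-irrefl refl (minimal l n≤′)))
    in N , G , universal , λ s n≤s → ≤-trans (bound s (minimal s n≤s))
         (≤-reflexive (cong (λ t → n ^ t * 2 ^ (num d * constant D (num d) * s)) (sym (2*∸ (<⇒≤ (den<num d 1<d))))))
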